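{- Let $\mathcal Y$ be an antisymmetric coherent configuration and $L$ a transitive permutation group of odd order. Then $gb(\mathcal Y\uparrow L)\le\max\{gb(\mathcal Y),b\}$ where $b=gb(\mathrm{Inv}(L))$. Moreover, if $\mathcal Y$ is not complete, then $b(\mathcal Y\uparrow L)\le b(\mathcal Y)+\max\{0,\,b-\lceil(b(\mathcal Y)-1)/2\rceil\}$.
   Context: A coherent configuration on a finite set $\Omega$ is $(\Omega,S)$ with $S$ a partition of $\Omega\times\Omega$ such that $1_\Omega$ is a union of elements of $S$, $s^*=\{(\beta,\alpha):(\alpha,\beta)\in s\}\in S$, and for $r,s,t\in S$ the number $|\{\gamma:(\alpha,\gamma)\in r,(\gamma,\beta)\in s\}|$ is independent of $(\alpha,\beta)\in t$; relations are unions of elements of $S$, fibers are sets $\Gamma$ with $1_\Gamma\in S$; antisymmetric: every $s\in S$ with $s=s^*$ lies in $1_\Omega$; complete: all elements of $S$ are singletons. A fission is a configuration on the same set whose relations include those of the given one. For $\Pi\subseteq2^\Omega$ the $\Pi$-fission is the smallest fission in which each member of $\Pi$ is a union of fibers; $\Pi$ is a generalized base if the $\Pi$-fission is complete; $B\subseteq\Omega$ is a base if $\{\{\beta\}:\beta\in B\}$ is a generalized base; $gb$ and $b$ are the minimal sizes. $\mathrm{Inv}(L)=(\Delta,\text{orbits of }L\text{ on }\Delta^2)$. Exponentiation: for $\mathcal Y=(\Gamma,T)$ and $L\le\mathrm{Sym}(\Delta)$, $\Delta=\{1,\dots,m\}$, with $t_1\otimes\dots\otimes t_m=\{(\alpha,\beta)\in\Gamma^m\times\Gamma^m:(\alpha_i,\beta_i)\in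 t_i\ \forall i\}$ and $L$ acting on $\Gamma^m$ by permuting coordinates, $\mathcal Y\uparrow L=(\Gamma^m,\{\bigcup_{l\in L}t^l:t=t_1\otimes\dots\otimes t_m,\ t_i\in T\})$. -}

module Defs where

open import Level using (0ℓ)
open import Data.Nat.Base using (ℕ; _^_; _≤_; _%_)
open import Data.Fin.Base using (Fin; finToFun; funToFin)
open import Data.Fin.Properties using (_≟_; all?)
open import Data.Fin.Permutation using (Permutation′; _⟨$⟩ʳ_; _⟨$⟩ˡ_; _≈_; _∘ₚ_; id; flip)
open import Data.Fin.Subset using (Subset; _∈_; ⊤; ⋃; ⁅_⁆; ∣_∣)
open import Data.Fin.Subset.Properties using (_∈?_)
open import Data.List.Base using (List; length; tabulate)
open import Data.List.Relation.Unary.All using (All)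
open import Data.List.Relation.Unary.Any using (any?)
open import Data.List.Relation.Unary.Unique.Propositional using (Unique)
import Data.List.Membership.Propositional as List
open import Data.Vec.Base using (Vec; lookup)
import Data.Vec.Base as Vec
open import Data.Product.Base using (∃; ∃₂; _×_)
open import Relation.Binary.Core using (Rel)
open import Relation.Binary.Definitions using (Decidable)
open import Relation.Binary.PropositionalEquality.Core using (_≡_)
open import Relation.Nullary.Decidable using (does; _×-dec_)
open import Relation.Unary using (Pred)

private
  variable
    m n : ℕ

IsMinimum : ∀ {a} → Pred ℕ a → Pred ℕ a
IsMinimum P k = P k × (∀ j → P j → k ≤ j)

-- The ground set Ω is Fin n.  A subset of Ω × Ω is stored as its 0/1 adjacency
-- matrix, so that equality of relations is propositional equality.
Relation : ℕ → Set
Relation n = Vec (Subset n) n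

infix 4 _∋⟨_,_⟩ _∋⟨_,_⟩? _⊆ᴿ_

_∋⟨_,_⟩ : Relation n → Fin n → Fin n → Set
s ∋⟨ α , β ⟩ = β ∈ lookup s α

_∋⟨_,_⟩? : (s : Relation n) → Decidable (s ∋⟨_,_⟩)
s ∋⟨ α , β ⟩? = β ∈? lookup s α

relation : {R : Rel (Fin n) 0ℓ} → Decidable R → Relation n
relation R? = Vec.tabulate λ α → Vec.tabulate λ β → does (R? α β)

_⊆ᴿ_ : Relation n → Relation n → Set
r ⊆ᴿ s = ∀ {α β} → r ∋⟨ α , β ⟩ → s ∋⟨ α , β ⟩

⋃ᴿ : List (Relation n) → Relation n
⋃ᴿ ss = relation (λ α β → any? (_∋⟨ α , β ⟩?) ss)

pair : Fin n → Fin n → Relation n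
pair α β = relation (λ α′ β′ → α ≟ α′ ×-dec β ≟ β′)

-- 1_Γ
diagonal : Subset n → Relation n
diagonal Γ = relation (λ α β → α ≟ β ×-dec α ∈? Γ)

infix 8 _ᵀ

-- s*
_ᵀ : Relation n → Relation n
s ᵀ = relation (λ α β → s ∋⟨ β , α ⟩?)

-- |{ γ : (α , γ) ∈ r , (γ , β) ∈ s }|
paths : Relation n → Relation n → Fin n → Fin n → ℕ
paths r s α β = ∣ Vec.tabulate (λ γ → does (r ∋⟨ α , γ ⟩? ×-dec s ∋⟨ γ , β ⟩?)) ∣

-- A configuration on Fin n is given by its set S of basis relations.
Configuration : ℕ → Set₁
Configuration n = Pred (Relation n) 0ℓ

IsRelationOf : Configuration n → Pred (Relation n) 0ℓ
IsRelationOf S R = ∃ λ ss → All S ss × R ≡ ⋃ᴿ ss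

record IsCoherent (S : Configuration n) : Set where
  field
    nonempty     : ∀ {s} → S s → ∃₂ λ α β → s ∋⟨ α , β ⟩
    covering     : ∀ α β → ∃ λ s → S s × s ∋⟨ α , β ⟩
    disjoint     : ∀ {r s α β} → S r → S s → r ∋⟨ α , β ⟩ → s ∋⟨ α , β ⟩ → r ≡ s
    reflexive    : IsRelationOf S (diagonal ⊤)
    converse     : ∀ {s} → S s → S (s ᵀ)
    intersection : ∀ {r s t} → S r → S s → S t →
                   ∀ {α β α′ β′} → t ∋⟨ α , β ⟩ → t ∋⟨ α′ , β′ ⟩ →
                   paths r s α β ≡ paths r s α′ β′

IsFiberOf : Configuration n → Pred (Subset n) 0ℓ
IsFiberOf S Γ = S (diagonal Γ)

IsUnionOfFibers : Configuration n → Pred (Subset n) 0ℓ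
IsUnionOfFibers S X = ∃ λ Γs → All (IsFiberOf S) Γs × X ≡ ⋃ Γs

IsAntisymmetric : Configuration n → Set
IsAntisymmetric S = ∀ {s} → S s → s ≡ s ᵀ → s ⊆ᴿ diagonal ⊤

IsComplete : Configuration n → Set
IsComplete S = ∀ {s} → S s → ∃₂ λ α β → s ≡ pair α β

-- S′ is a fission of S.
IsFission : (S S′ : Configuration n) → Set
IsFission S S′ = IsCoherent S′ × (∀ {R} → IsRelationOf S R → IsRelationOf S′ R)

-- S′ is a fission of S in which every member of Π is a union of fibers.
IsSplittingFission : Configuration n → Pred (Subset n) 0ℓ → Configuration n → Set
IsSplittingFission S Π S′ = IsFission S S′ × (∀ {X} → Π X → IsUnionOfFibers S′ X)

-- S′ is the Π-fission of S; "smallest" means that every competitor S″ is a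
-- fission of S′.
IsΠFission : Configuration n → Pred (Subset n) 0ℓ → Configuration n → Set₁
IsΠFission S Π S′ =
  IsSplittingFission S Π S′ × (∀ S″ → IsSplittingFission S Π S″ → IsFission S′ S″)

IsGeneralizedBase : Configuration n → Pred (Subset n) 0ℓ → Set₁
IsGeneralizedBase S Π = ∃ λ S′ → IsΠFission S Π S′ × IsComplete S′

singletons : Subset n → Pred (Subset n) 0ℓ
singletons B X = ∃ λ β → β ∈ B × X ≡ ⁅ β ⁆

IsBase : Configuration n → Subset n → Set₁
IsBase S B = IsGeneralizedBase S (singletons B)

-- gb(S) = k
Isgb : Configuration n → ℕ → Set₁
Isgb S = IsMinimum λ k →
  ∃ λ Π → Unique Π × length Π ≡ k × IsGeneralizedBase S (List._∈ Π)

-- b(S) = k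
Isb : Configuration n → ℕ → Set₁
Isb S = IsMinimum λ k → ∃ λ B → ∣ B ∣ ≡ k × IsBase S B

-- A subgroup of Sym(Δ), Δ = Fin m, listed without repetition.
record PermutationGroup (m : ℕ) : Set where
  field
    order     : ℕ
    element   : Fin order → Permutation′ m
    distinct  : ∀ {i j} → element i ≈ element j → i ≡ j
    identity  : ∃ λ i → element i ≈ id
    composite : ∀ i j → ∃ λ k → element k ≈ element i ∘ₚ element j
    inverse   : ∀ i → ∃ λ j → element j ≈ flip (element i)

open PermutationGroup public using (order; element)

IsTransitive : PermutationGroup m → Set
IsTransitive L = ∀ i j → ∃ λ l → element L l ⟨$⟩ʳ i ≡ j

HasOddOrder : PermutationGroup m → Set
HasOddOrder L = order L % 2 ≡ 1

orbit : PermutationGroup m → Fin m → Fin m → Relation m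
orbit L i j = ⋃ᴿ (tabulate λ l → pair (element L l ⟨$⟩ʳ i) (element L l ⟨$⟩ʳ j))

Inv : PermutationGroup m → Configuration m
Inv L s = ∃₂ λ i j → s ≡ orbit L i j

-- For Γ = Fin n, the tuple α ∈ Γ^m is coded by an element of Fin (n ^ m), with
-- i-th coordinate  finToFun α i.

⨂ : (Fin m → Relation n) → Relation (n ^ m)
⨂ t = relation (λ α β → all? (λ i → t i ∋⟨ finToFun α i , finToFun β i ⟩?))

-- l moves the i-th coordinate to position l(i): (α^l)_{l(i)} = α_i.
permute : ∀ n → Permutation′ m → Fin (n ^ m) → Fin (n ^ m)
permute n l α = funToFin {n = n} (λ i → finToFun α (l ⟨$⟩ˡ i))

-- t^l = { (α^l , β^l) : (α , β) ∈ t }, written as a preimage under l⁻¹.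
permuteRelation : ∀ n → Permutation′ m → Relation (n ^ m) → Relation (n ^ m)
permuteRelation n l t =
  relation (λ α β → t ∋⟨ permute n (flip l) α , permute n (flip l) β ⟩?)

infix 7 _↑_

_↑_ : Configuration n → PermutationGroup m → Configuration (n ^ m)
_↑_ {n} {m} T L s = ∃ λ (t : Fin m → Relation n) →
  (∀ i → T (t i)) × s ≡ ⋃ᴿ (tabulate λ l → permuteRelation n (element L l) (⨂ t))

{-# OPTIONS --safe #-}

-- Let 𝒮 be a fission of Y ↑ L in which certain products Z = Q₁ × … × Qₘ of nonempty sets Qⱼ ⊆ Γ are
-- unions of fibers.  Two points differing in one coordinate determine the line through them, so 𝒮
-- induces a coherent configuration on each line ≅ Γ.  The Hamming distance to Z is constant on
-- fibers, and along a line in direction j it detects Qⱼ; hence the induced configuration is a fission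
-- of Y in which the sets Qⱼ are split, and it is complete as soon as these sets form a generalized
-- base of Y.  A colour-preserving bijection between two lines of directions j and j′ is then an
-- automorphism f of Y with f(Qⱼ) = Qⱼ′ for all products.  The sets Qⱼ are chosen from a
-- generalized base D₁, …, D_b of Inv(L) in such a way that f must be the identity and j, j′ lie in
-- the same sets Dᵢ:
--   * for gb, Qⱼ is X or its complement, according to whether j ∈ D;
--   * for b, two base points x, y yield the tuples with coordinates x on D, y off D and vice versa,
--     so that ⌊b(Y)/2⌋ of the sets Dᵢ are encoded without additional points.
-- In both cases a discrepancy between j and j′ makes f exchange two sets or two points, which
-- antisymmetry forbids.  Consequently a constant tuple o is a fiber of 𝒮, the tuples that differ
-- from o by the value y in one coordinate carry a fission of Inv(L) splitting all Dᵢ, hence are fibers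
-- too, and the distances to o and to these tuples determine any point.

module Submission where

open import Defs
open import Level using (0ℓ)
open import Data.Bool.Base using (true; if_then_else_)
import Data.Bool.Properties as Bool
open import Data.Nat.Base using (ℕ; zero; suc; _+_; _*_; _∸_; _^_; _%_; _/_; _≤_; _<_; _⊔_; ⌈_/2⌉; ⌊_/2⌋; z≤n; s≤s; s<s)
import Data.Nat.Properties as ℕ
open import Data.Nat.DivMod using (m≡m%n+[m/n]*n; m%n<n)
open import Data.Nat.GeneralisedArithmetic using (fold; fold-+)
open import Data.Nat.Induction using (<-wellFounded)
open import Data.Fin.Base using (Fin; zero; suc; toℕ; fromℕ<; inject≤; combine; finToFun; funToFin)
open import Data.Fin.Properties using (_≟_; all?; injective⇒≤; suc-injective; inject≤-injective; pigeonhole; toℕ-fromℕ<; finToFun-funToFin; funToFin-finToFin)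
import Data.Fin.Properties as Fin
open import Data.Fin.Permutation using (Permutation′; _⟨$⟩ʳ_; _⟨$⟩ˡ_; inverseˡ; inverseʳ; flip)
open import Data.Fin.Subset using (Subset; inside; outside; _∈_; _∉_; ⊤; ⊥; ∁; _∪_; ⋃; ⁅_⁆; ∣_∣; Nonempty)
open import Data.Fin.Subset.Properties using (_∈?_; nonempty?; ⊆-antisym; ∈⊤; ∉⊥; x∈⁅x⁆; x∈⁅y⁆⇒x≡y; x∈∁p⇒x∉p; x∉p⇒x∈∁p; x∉∁p⇒x∈p; x∈p∪q⁺; x∈p∪q⁻; p⊆q⇒∣p∣≤∣q∣; p⊂q⇒∣p∣<∣q∣; ∣⊥∣≡0; ∣⁅x⁆∣≡1)
open import Data.List.Base using (List; []; _∷_; map; filter; length; tabulate; allFin; cartesianProduct; deduplicate)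
open import Data.List.Properties using (length-map; length-tabulate; length-deduplicate)
open import Data.List.Membership.Propositional using (lose; find)
import Data.List.Membership.Propositional as List
open import Data.List.Membership.Propositional.Properties using (∈-map⁺; ∈-map⁻; ∈-filter⁺; ∈-filter⁻; ∈-allFin; ∈-tabulate⁺; ∈-cartesianProduct⁺; ∈-deduplicate⁺)
open import Data.List.Relation.Unary.All as All using (All; []; _∷_)
import Data.List.Relation.Unary.All.Properties as All
open import Data.List.Relation.Unary.AllPairs using ([]; _∷_)
open import Data.List.Relation.Unary.Any using (Any; here; there; any?)
open import Data.List.Relation.Unary.Any.Properties using (tabulate⁺; tabulate⁻)
open import Data.List.Relation.Unary.Unique.Propositional using (Unique)
import Data.List.Relation.Unary.Unique.Propositional.Properties as Unique
import Data.List.Relation.Unary.Unique.DecPropositional.Properties as DecUnique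
open import Data.Vec.Base using ([]; _∷_; lookup; here; there)
import Data.Vec.Base as Vec
open import Data.Vec.Properties using (lookup∘tabulate; tabulate∘lookup; tabulate-cong; lookup⇒[]=; []=⇒lookup; ≡-dec)
open import Data.Product.Base using (∃; ∃₂; _×_; _,_; proj₁; proj₂; swap; uncurry)
import Data.Product.Properties as Product
open import Data.Sum.Base using (_⊎_; inj₁; inj₂)
open import Function.Base using (_∘_; id; const)
open import Function.Definitions using (Injective)
open import Induction.WellFounded using (Acc; acc)
open import Relation.Binary.Core using (Rel)
open import Relation.Binary.Definitions using (Decidable; DecidableEquality)
open import Relation.Binary.Structures using (IsEquivalence)
open import Relation.Binary.PropositionalEquality using (_≡_; _≢_; refl; sym; trans; cong; cong₂; subst; subst₂; ≢-sym; module ≡-Reasoning)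
open import Relation.Nullary.Decidable using (Dec; yes; no; does; dec-true; map′; _×-dec_; ¬?)
open import Relation.Nullary.Negation.Core using (¬_; contradiction)
open import Relation.Unary using (Pred)
import Relation.Unary as Unary

private
  variable
    k m n : ℕ

-- Membership in subsets and relations given by decision procedures.

does-true⇒ : ∀ {A : Set} (a? : Dec A) → does a? ≡ true → A
does-true⇒ (yes a) _ = a

⟦_⟧ : {P : Pred (Fin n) 0ℓ} → Unary.Decidable P → Subset n
⟦ P? ⟧ = Vec.tabulate (does ∘ P?)

module _ {P : Pred (Fin n) 0ℓ} (P? : Unary.Decidable P) where

  ∈⟦⟧⁺ : ∀ {x} → P x → x ∈ ⟦ P? ⟧
  ∈⟦⟧⁺ {x} px = lookup⇒[]= x _ (trans (lookup∘tabulate _ x) (dec-true (P? x) px))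

  ∈⟦⟧⁻ : ∀ {x} → x ∈ ⟦ P? ⟧ → P x
  ∈⟦⟧⁻ {x} x∈ = does-true⇒ (P? x) (trans (sym (lookup∘tabulate _ x)) ([]=⇒lookup x∈))

module _ {R : Rel (Fin n) 0ℓ} (R? : Decidable R) where

  ∋-relation⁺ : ∀ {α β} → R α β → relation R? ∋⟨ α , β ⟩
  ∋-relation⁺ {α} {β} r = subst (β ∈_) (sym (lookup∘tabulate _ α)) (∈⟦⟧⁺ (R? α) r)

  ∋-relation⁻ : ∀ {α β} → relation R? ∋⟨ α , β ⟩ → R α β
  ∋-relation⁻ {α} {β} r = ∈⟦⟧⁻ (R? α) (subst (β ∈_) (lookup∘tabulate _ α) r)

⊆ᴿ-antisym : {r s : Relation n} → r ⊆ᴿ s → s ⊆ᴿ r → r ≡ s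
⊆ᴿ-antisym {r = r} {s} r⊆s s⊆r = begin
  r                        ≡⟨ tabulate∘lookup r ⟨
  Vec.tabulate (lookup r)  ≡⟨ tabulate-cong (λ _ → ⊆-antisym r⊆s s⊆r) ⟩
  Vec.tabulate (lookup s)  ≡⟨ tabulate∘lookup s ⟩
  s                        ∎
  where open ≡-Reasoning

∋-ᵀ⁺ : ∀ (s : Relation n) {α β} → s ∋⟨ α , β ⟩ → (s ᵀ) ∋⟨ β , α ⟩
∋-ᵀ⁺ s = ∋-relation⁺ (λ α β → s ∋⟨ β , α ⟩?)

∋-ᵀ⁻ : ∀ (s : Relation n) {α β} → (s ᵀ) ∋⟨ β , α ⟩ → s ∋⟨ α , β ⟩
∋-ᵀ⁻ s = ∋-relation⁻ (λ α β → s ∋⟨ β , α ⟩?)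

∋-⋃ᴿ⁺ : ∀ (ss : List (Relation n)) {α β} → Any (_∋⟨ α , β ⟩) ss → ⋃ᴿ ss ∋⟨ α , β ⟩
∋-⋃ᴿ⁺ ss = ∋-relation⁺ (λ α β → any? (_∋⟨ α , β ⟩?) ss)

∋-⋃ᴿ⁻ : ∀ (ss : List (Relation n)) {α β} → ⋃ᴿ ss ∋⟨ α , β ⟩ → Any (_∋⟨ α , β ⟩) ss
∋-⋃ᴿ⁻ ss = ∋-relation⁻ (λ α β → any? (_∋⟨ α , β ⟩?) ss)

∋-diagonal⁺ : ∀ (Γ : Subset n) {α} → α ∈ Γ → diagonal Γ ∋⟨ α , α ⟩
∋-diagonal⁺ Γ α∈Γ = ∋-relation⁺ (λ α β → α ≟ β ×-dec α ∈? Γ) (refl , α∈Γ)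

∋-diagonal⁻ : ∀ (Γ : Subset n) {α β} → diagonal Γ ∋⟨ α , β ⟩ → α ≡ β × α ∈ Γ
∋-diagonal⁻ Γ = ∋-relation⁻ (λ α β → α ≟ β ×-dec α ∈? Γ)

∋-pair⁺ : ∀ (α β : Fin n) → pair α β ∋⟨ α , β ⟩
∋-pair⁺ α β = ∋-relation⁺ (λ α′ β′ → α ≟ α′ ×-dec β ≟ β′) (refl , refl)

∋-pair⁻ : ∀ {α β α′ β′ : Fin n} → pair α β ∋⟨ α′ , β′ ⟩ → α ≡ α′ × β ≡ β′
∋-pair⁻ {α = α} {β} = ∋-relation⁻ (λ α′ β′ → α ≟ α′ ×-dec β ≟ β′)

∈-⋃⁺ : ∀ {x : Fin n} {Γs} → Any (x ∈_) Γs → x ∈ ⋃ Γs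
∈-⋃⁺ (here x∈Γ)  = x∈p∪q⁺ (inj₁ x∈Γ)
∈-⋃⁺ (there any) = x∈p∪q⁺ (inj₂ (∈-⋃⁺ any))

∈-⋃⁻ : ∀ {x : Fin n} Γs → x ∈ ⋃ Γs → Any (x ∈_) Γs
∈-⋃⁻ []       x∈ = contradiction x∈ ∉⊥
∈-⋃⁻ (Γ ∷ Γs) x∈ with x∈p∪q⁻ Γ (⋃ Γs) x∈
... | inj₁ x∈Γ = here x∈Γ
... | inj₂ x∈⋃ = there (∈-⋃⁻ Γs x∈⋃)

-- Counting elements of finite sets through injections

nth : (p : Subset n) → Fin ∣ p ∣ → Fin n
nth (inside  ∷ p) zero    = zero
nth (inside  ∷ p) (suc i) = suc (nth p i)
nth (outside ∷ p) i       = suc (nth p i)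

nth-∈ : (p : Subset n) (i : Fin ∣ p ∣) → nth p i ∈ p
nth-∈ (inside  ∷ p) zero    = here
nth-∈ (inside  ∷ p) (suc i) = there (nth-∈ p i)
nth-∈ (outside ∷ p) i       = there (nth-∈ p i)

nth-injective : (p : Subset n) → Injective _≡_ _≡_ (nth p)
nth-injective (inside  ∷ p) {zero}  {zero}  _  = refl
nth-injective (inside  ∷ p) {suc i} {suc j} eq = cong suc (nth-injective p (suc-injective eq))
nth-injective (outside ∷ p) eq = nth-injective p (suc-injective eq)

rank : ∀ {p : Subset n} {x} → x ∈ p → Fin ∣ p ∣
rank here                          = zero
rank {p = inside  ∷ _} (there x∈p) = suc (rank x∈p)
rank {p = outside ∷ _} (there x∈p) = rank x∈p

nth-rank : ∀ {p : Subset n} {x} (x∈p : x ∈ p) → nth p (rank x∈p) ≡ x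
nth-rank here                          = refl
nth-rank {p = inside  ∷ _} (there x∈p) = cong suc (nth-rank x∈p)
nth-rank {p = outside ∷ _} (there x∈p) = cong suc (nth-rank x∈p)

rank-injective : ∀ {p : Subset n} {x y} (x∈p : x ∈ p) (y∈p : y ∈ p) → rank x∈p ≡ rank y∈p → x ≡ y
rank-injective {p = p} x∈p y∈p eq = trans (sym (nth-rank x∈p)) (trans (cong (nth p) eq) (nth-rank y∈p))

∣∣-mono-injection : ∀ {p : Subset n} {q : Subset k} (f : Fin n → Fin k) → (∀ {x} → x ∈ p → f x ∈ q) →
                    (∀ {x y} → x ∈ p → y ∈ p → f x ≡ f y → x ≡ y) → ∣ p ∣ ≤ ∣ q ∣
∣∣-mono-injection {p = p} f maps inj = injective⇒≤ {f = λ i → rank (maps (nth-∈ p i))}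
  λ {i} {j} eq → nth-injective p (inj (nth-∈ p i) (nth-∈ p j) (rank-injective (maps (nth-∈ p i)) (maps (nth-∈ p j)) eq))

∣∣-≤⇒injection : ∀ (p q : Subset n) → ∣ p ∣ ≤ ∣ q ∣ → ∃ λ (f : Fin n → Fin n) →
                 (∀ {x} → x ∈ p → f x ∈ q) × (∀ {x y} → x ∈ p → y ∈ p → f x ≡ f y → x ≡ y)
∣∣-≤⇒injection {n} p q h = f , maps , inj
  where
  f : Fin n → Fin n
  f x with x ∈? p
  ... | yes x∈p = nth q (inject≤ (rank x∈p) h)
  -- Any value would do, since nothing is claimed about `f` outside `p`.
  ... | no  _   = x

  maps : ∀ {x} → x ∈ p → f x ∈ q
  maps {x} x∈p with x ∈? p
  ... | yes _   = nth-∈ q _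
  ... | no  x∉p = contradiction x∈p x∉p

  inj : ∀ {x y} → x ∈ p → y ∈ p → f x ≡ f y → x ≡ y
  inj {x} {y} x∈p y∈p eq with x ∈? p | y ∈? p
  ... | yes a   | yes b   = rank-injective a b (inject≤-injective h h _ _ (nth-injective q eq))
  ... | no  x∉p | _       = contradiction x∈p x∉p
  ... | yes _   | no  y∉p = contradiction y∈p y∉p

-- Injections between the fibers of `F` and those of `G` are glued together. Each is chosen from the
-- key alone, so points with equal keys use the same injection, while points with different keys
-- land in disjoint fibers of `G`.
matching : ∀ {K : Set} (_≟ᴷ_ : DecidableEquality K) (F G : Fin n → K) →
           (∀ x → ∣ ⟦ (λ y → F y ≟ᴷ F x) ⟧ ∣ ≤ ∣ ⟦ (λ y → G y ≟ᴷ F x) ⟧ ∣) →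
           ∃ λ (π : Fin n → Fin n) → Injective _≡_ _≡_ π × (∀ x → F x ≡ G (π x))
matching {n} {K} _≟ᴷ_ F G F≤G = π , π-injective , π-matches
  where
  fibre : (Fin n → K) → K → Subset n
  fibre H key = ⟦ (λ y → H y ≟ᴷ key) ⟧

  module _ (key : K) where
    select : Dec (∣ fibre F key ∣ ≤ ∣ fibre G key ∣) → Fin n → Fin n
    select (yes h) = proj₁ (∣∣-≤⇒injection _ _ h)
    -- `F≤G` excludes this case for every key that is a value of `F`.
    select (no  _) = id

    decision = ∣ fibre F key ∣ ℕ.≤? ∣ fibre G key ∣

    select-matches : ∀ d {x} → F x ≡ key → ∣ fibre F key ∣ ≤ ∣ fibre G key ∣ → G (select d x) ≡ key
    select-matches (yes h) eq _  = ∈⟦⟧⁻ (λ y → G y ≟ᴷ key)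
      (proj₁ (proj₂ (∣∣-≤⇒injection _ _ h)) (∈⟦⟧⁺ (λ y → F y ≟ᴷ key) eq))
    select-matches (no ¬h) eq h = contradiction h ¬h

    select-injective : ∀ d {x y} → F x ≡ key → F y ≡ key → select d x ≡ select d y → x ≡ y
    select-injective (yes h) ex ey = proj₂ (proj₂ (∣∣-≤⇒injection _ _ h))
      (∈⟦⟧⁺ (λ y → F y ≟ᴷ key) ex) (∈⟦⟧⁺ (λ y → F y ≟ᴷ key) ey)
    select-injective (no _) _ _ eq = eq

  π : Fin n → Fin n
  π x = select (F x) (decision (F x)) x

  π-matches : ∀ x → F x ≡ G (π x)
  π-matches x = sym (select-matches (F x) (decision (F x)) refl (F≤G x))

  π-injective : Injective _≡_ _≡_ π
  π-injective {x} {y} eq = select-injective (F x) (decision (F x)) refl (sym Fx≡Fy)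
    (trans eq (cong (λ key → select key (decision key) y) (sym Fx≡Fy)))
    where
    Fx≡Fy : F x ≡ F y
    Fx≡Fy = trans (π-matches x) (trans (cong G eq) (sym (π-matches y)))

-- Coherent configurations as equivalence relations on pairs of points

-- Two pairs are equivalent when they lie in the same basis relation; the intersection numbers are
-- encoded by a matching π of the paths joining the two pairs.
record CoherentEquivalence (n : ℕ) : Set₁ where
  infix 4 _~_ _~?_
  field
    _~_           : Rel (Fin n × Fin n) 0ℓ
    _~?_          : Decidable _~_
    isEquivalence : IsEquivalence _~_
    ~-converse    : ∀ {α β α′ β′} → (α , β) ~ (α′ , β′) → (β , α) ~ (β′ , α′)
    ~-diagonal    : ∀ {α β γ} → (α , α) ~ (β , γ) → β ≡ γ
    ~-paths       : ∀ {α β α′ β′} → (α , β) ~ (α′ , β′) → ∃ λ (π : Fin n → Fin n) →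
                    Injective _≡_ _≡_ π × (∀ γ → (α , γ) ~ (α′ , π γ) × (γ , β) ~ (π γ , β′))

  open IsEquivalence isEquivalence public renaming (refl to ~-refl; sym to ~-sym; trans to ~-trans)

  -- The path through α itself has first step (α , α), so `~-diagonal` forces π to send α to α′.
  ~-source : ∀ {α β α′ β′} → (α , β) ~ (α′ , β′) → (α , α) ~ (α′ , α′)
  ~-source {α} {α′ = α′} p with π , _ , moves ← ~-paths p with q , _ ← moves α =
    subst (λ γ → (α , α) ~ (α′ , γ)) (sym (~-diagonal q)) q

  ~-target : ∀ {α β α′ β′} → (α , β) ~ (α′ , β′) → (β , β) ~ (β′ , β′)
  ~-target p = ~-source (~-converse p)

  ~-irreflexive : ∀ {α β α′ β′} → (α , β) ~ (α′ , β′) → α′ ≡ β′ → α ≡ β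
  ~-irreflexive p refl = ~-diagonal (~-sym p)

  configuration : Configuration n
  configuration s = ∃₂ λ α β → s ≡ relation (λ α′ β′ → (α , β) ~? (α′ , β′))

  Discrete : Set
  Discrete = ∀ {α β} → (α , α) ~ (β , β) → α ≡ β

  Refines : Configuration n → Set
  Refines S = ∀ s {α β α′ β′} → S s → s ∋⟨ α , β ⟩ → (α , β) ~ (α′ , β′) → s ∋⟨ α′ , β′ ⟩

  Splits : Subset n → Set
  Splits X = ∀ {x y} → x ∈ X → (x , x) ~ (y , y) → y ∈ X

-- From coherent configurations to equivalences.

module FromCoherent {S : Configuration n} (coherent : IsCoherent S) where
  open IsCoherent coherent

  colour : Fin n → Fin n → Relation n
  colour α β = proj₁ (covering α β)

  colour-basis : ∀ α β → S (colour α β)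
  colour-basis α β = proj₁ (proj₂ (covering α β))

  ∋-colour : ∀ α β → colour α β ∋⟨ α , β ⟩
  ∋-colour α β = proj₂ (proj₂ (covering α β))

  colour-unique : ∀ {s α β} → S s → s ∋⟨ α , β ⟩ → s ≡ colour α β
  colour-unique Ss s∋ = disjoint Ss (colour-basis _ _) s∋ (∋-colour _ _)

  ∋-colour-≡ : ∀ {α β α′ β′} → colour α β ≡ colour α′ β′ → colour α β ∋⟨ α′ , β′ ⟩
  ∋-colour-≡ {α′ = α′} {β′} eq = subst (_∋⟨ α′ , β′ ⟩) (sym eq) (∋-colour α′ β′)

  basis-invariant : ∀ {s α β α′ β′} → S s → s ∋⟨ α , β ⟩ → colour α β ≡ colour α′ β′ → s ∋⟨ α′ , β′ ⟩
  basis-invariant {α′ = α′} {β′} Ss s∋ eq = subst (_∋⟨ α′ , β′ ⟩) (sym (colour-unique Ss s∋)) (∋-colour-≡ eq)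

  relation-invariant : ∀ {R α β α′ β′} → IsRelationOf S R → R ∋⟨ α , β ⟩ →
                       colour α β ≡ colour α′ β′ → R ∋⟨ α′ , β′ ⟩
  relation-invariant (ss , Sss , refl) R∋ eq with s , s∈ss , s∋ ← find (∋-⋃ᴿ⁻ ss R∋) =
    ∋-⋃ᴿ⁺ ss (lose s∈ss (basis-invariant (All.lookup Sss s∈ss) s∋ eq))

  -- `R` is the union of the colours of its own pairs; invariance keeps these colours inside `R`.
  invariant⇒relation : ∀ R → (∀ {α β α′ β′} → R ∋⟨ α , β ⟩ → colour α β ≡ colour α′ β′ → R ∋⟨ α′ , β′ ⟩) →
                       IsRelationOf S R
  invariant⇒relation R invariant = ss , Sss , ⊆ᴿ-antisym R⊆ ⊆R
    where
    members : List (Fin n × Fin n)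
    members = filter (uncurry (R ∋⟨_,_⟩?)) (cartesianProduct (allFin n) (allFin n))

    ss : List (Relation n)
    ss = map (uncurry colour) members

    Sss : All S ss
    Sss = All.map⁺ (All.tabulate λ {(α , β)} _ → colour-basis α β)

    R⊆ : R ⊆ᴿ ⋃ᴿ ss
    R⊆ {α} {β} R∋ = ∋-⋃ᴿ⁺ ss (lose (∈-map⁺ (uncurry colour)
      (∈-filter⁺ (uncurry (R ∋⟨_,_⟩?)) (∈-cartesianProduct⁺ (∈-allFin α) (∈-allFin β)) R∋)) (∋-colour α β))

    ⊆R : ⋃ᴿ ss ⊆ᴿ R
    ⊆R r with s , s∈ss , s∋ ← find (∋-⋃ᴿ⁻ ss r)
         with (α , β) , αβ∈ , refl ← ∈-map⁻ (uncurry colour) s∈ss =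
      invariant (proj₂ (∈-filter⁻ (uncurry (R ∋⟨_,_⟩?)) {xs = cartesianProduct (allFin n) (allFin n)} αβ∈))
        (colour-unique (colour-basis α β) s∋)

  fibres-invariant : ∀ {X x y} → IsUnionOfFibers S X → x ∈ X → colour x x ≡ colour y y → y ∈ X
  fibres-invariant (Γs , fibers , refl) x∈ eq with Γ , Γ∈ , x∈Γ ← find (∈-⋃⁻ Γs x∈) =
    ∈-⋃⁺ (lose Γ∈ (proj₂ (∋-diagonal⁻ Γ (basis-invariant (All.lookup fibers Γ∈) (∋-diagonal⁺ Γ x∈Γ) eq))))

  _≟ᴿ_ : DecidableEquality (Relation n)
  _≟ᴿ_ = ≡-dec (≡-dec Bool._≟_)

  equivalence : CoherentEquivalence n
  equivalence = record
    { _~_           = λ (α , β) (α′ , β′) → colour α β ≡ colour α′ β′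
    ; _~?_          = λ (α , β) (α′ , β′) → colour α β ≟ᴿ colour α′ β′
    ; isEquivalence = record { refl = refl ; sym = sym ; trans = trans }
    ; ~-converse    = colour-converse
    ; ~-diagonal    = λ {α} eq → proj₁ (∋-diagonal⁻ ⊤ (relation-invariant reflexive (∋-diagonal⁺ ⊤ (∈⊤ {x = α})) eq))
    ; ~-paths       = colour-paths
    }
    where
    colour-converse : ∀ {α β α′ β′} → colour α β ≡ colour α′ β′ → colour β α ≡ colour β′ α′
    colour-converse {α} {β} {α′} {β′} eq = begin
      colour β α       ≡⟨ colour-unique (converse (colour-basis α β)) (∋-ᵀ⁺ (colour α β) (∋-colour α β)) ⟨
      colour α β ᵀ     ≡⟨ cong _ᵀ eq ⟩
      colour α′ β′ ᵀ   ≡⟨ colour-unique (converse (colour-basis α′ β′)) (∋-ᵀ⁺ (colour α′ β′) (∋-colour α′ β′)) ⟩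
      colour β′ α′     ∎
      where open ≡-Reasoning

    colour-paths : ∀ {α β α′ β′} → colour α β ≡ colour α′ β′ → ∃ λ (π : Fin n → Fin n) →
                   Injective _≡_ _≡_ π × (∀ γ → colour α γ ≡ colour α′ (π γ) × colour γ β ≡ colour (π γ) β′)
    colour-paths {α} {β} {α′} {β′} eq with matching _≟ᴷ_ (key α β) (key α′ β′) keys≤
      where
      _≟ᴷ_ : DecidableEquality (Relation n × Relation n)
      _≟ᴷ_ = Product.≡-dec _≟ᴿ_ _≟ᴿ_

      key : Fin n → Fin n → Fin n → Relation n × Relation n
      key α β γ = colour α γ , colour γ β

      -- The points with a given pair of colours are counted by an intersection number, which is the
      -- same for both pairs of end points.
      keys≤ : ∀ δ → ∣ ⟦ (λ γ → key α β γ ≟ᴷ key α β δ) ⟧ ∣ ≤ ∣ ⟦ (λ γ → key α′ β′ γ ≟ᴷ key α β δ) ⟧ ∣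
      keys≤ δ = begin
        ∣ ⟦ matched α β ⟧ ∣    ≤⟨ p⊆q⇒∣p∣≤∣q∣ (λ γ∈ → ∈⟦⟧⁺ (on α β) (to (∈⟦⟧⁻ (matched α β) γ∈))) ⟩
        paths r s α β          ≡⟨ intersection (colour-basis α δ) (colour-basis δ β)
                                                     (colour-basis α β) (∋-colour α β) (∋-colour-≡ eq) ⟩
        paths r s α′ β′        ≤⟨ p⊆q⇒∣p∣≤∣q∣ (λ γ∈ → ∈⟦⟧⁺ (matched α′ β′) (from (∈⟦⟧⁻ (on α′ β′) γ∈))) ⟩
        ∣ ⟦ matched α′ β′ ⟧ ∣  ∎
        where
        open ℕ.≤-Reasoning
        r = colour α δ
        s = colour δ β

        matched : ∀ α′ β′ γ → Dec (key α′ β′ γ ≡ key α β δ)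
        matched α′ β′ γ = key α′ β′ γ ≟ᴷ key α β δ

        on : ∀ α β γ → Dec (r ∋⟨ α , γ ⟩ × s ∋⟨ γ , β ⟩)
        on α β γ = r ∋⟨ α , γ ⟩? ×-dec s ∋⟨ γ , β ⟩?

        to : ∀ {γ} → key α β γ ≡ key α β δ → r ∋⟨ α , γ ⟩ × s ∋⟨ γ , β ⟩
        to e = ∋-colour-≡ (sym (cong proj₁ e)) , ∋-colour-≡ (sym (cong proj₂ e))

        from : ∀ {γ} → r ∋⟨ α′ , γ ⟩ × s ∋⟨ γ , β′ ⟩ → key α′ β′ γ ≡ key α β δ
        from (r∋ , s∋) = cong₂ _,_ (sym (colour-unique (colour-basis α δ) r∋)) (sym (colour-unique (colour-basis δ β) s∋))
    ... | π , π-injective , matches = π , π-injective , λ γ → cong proj₁ (matches γ) , cong proj₂ (matches γ)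

-- From equivalences to coherent configurations.

module ToCoherent (E : CoherentEquivalence n) where
  open CoherentEquivalence E

  basis : Fin n → Fin n → Relation n
  basis α β = relation (λ α′ β′ → (α , β) ~? (α′ , β′))

  ∋-basis⁺ : ∀ {α β α′ β′} → (α , β) ~ (α′ , β′) → basis α β ∋⟨ α′ , β′ ⟩
  ∋-basis⁺ {α} {β} = ∋-relation⁺ (λ α′ β′ → (α , β) ~? (α′ , β′))

  ∋-basis⁻ : ∀ {α β α′ β′} → basis α β ∋⟨ α′ , β′ ⟩ → (α , β) ~ (α′ , β′)
  ∋-basis⁻ {α} {β} = ∋-relation⁻ (λ α′ β′ → (α , β) ~? (α′ , β′))

  basis-cong : ∀ {α β α′ β′} → (α , β) ~ (α′ , β′) → basis α β ≡ basis α′ β′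
  basis-cong p = ⊆ᴿ-antisym (λ r → ∋-basis⁺ (~-trans (~-sym p) (∋-basis⁻ r)))
                            (λ r → ∋-basis⁺ (~-trans p (∋-basis⁻ r)))

  -- The injection of `~-paths` carries paths to paths of the same type. The symmetry of the
  -- equivalence gives the reverse inequality, hence the constancy of the intersection numbers.
  paths-≤ : ∀ {ρ σ τ υ α β α′ β′} → (α , β) ~ (α′ , β′) →
            paths (basis ρ σ) (basis τ υ) α β ≤ paths (basis ρ σ) (basis τ υ) α′ β′
  paths-≤ {ρ} {σ} {τ} {υ} {α} {β} {α′} {β′} p with π , π-injective , moves ← ~-paths p =
    ∣∣-mono-injection π
      (λ {γ} γ∈ → let r∋ , s∋ = ∈⟦⟧⁻ (on α β) γ∈ in
        ∈⟦⟧⁺ (on α′ β′) (∋-basis⁺ (~-trans (∋-basis⁻ r∋) (proj₁ (moves γ))) ,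
                         ∋-basis⁺ (~-trans (∋-basis⁻ s∋) (proj₂ (moves γ)))))
      (λ _ _ → π-injective)
    where
    on : ∀ α β γ → Dec (basis ρ σ ∋⟨ α , γ ⟩ × basis τ υ ∋⟨ γ , β ⟩)
    on α β γ = basis ρ σ ∋⟨ α , γ ⟩? ×-dec basis τ υ ∋⟨ γ , β ⟩?

  ~-covering : ∀ α β → ∃ λ s → configuration s × s ∋⟨ α , β ⟩
  ~-covering α β = basis α β , (α , β , refl) , ∋-basis⁺ ~-refl

  ~-reflexive : IsRelationOf configuration (diagonal ⊤)
  ~-reflexive = map (λ α → basis α α) (allFin n) , All.map⁺ (All.tabulate λ {α} _ → α , α , refl) ,
    ⊆ᴿ-antisym to from
    where
    to : diagonal ⊤ ⊆ᴿ ⋃ᴿ (map (λ α → basis α α) (allFin n))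
    to {α} d with refl , _ ← ∋-diagonal⁻ ⊤ d =
      ∋-⋃ᴿ⁺ _ (lose (∈-map⁺ (λ α → basis α α) (∈-allFin α)) (∋-basis⁺ ~-refl))

    from : ⋃ᴿ (map (λ α → basis α α) (allFin n)) ⊆ᴿ diagonal ⊤
    from r with s , s∈ , s∋ ← find (∋-⋃ᴿ⁻ (map (λ α → basis α α) (allFin n)) r) with γ , _ , refl ← ∈-map⁻ (λ α → basis α α) s∈
           with refl ← ~-diagonal (∋-basis⁻ s∋) = ∋-diagonal⁺ ⊤ ∈⊤

  coherent : IsCoherent configuration
  coherent = record
    { nonempty     = λ { (α , β , refl) → α , β , ∋-basis⁺ ~-refl }
    ; covering     = ~-covering
    ; disjoint     = λ { (_ , _ , refl) (_ , _ , refl) r∋ s∋ →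
                         basis-cong (~-trans (∋-basis⁻ r∋) (~-sym (∋-basis⁻ s∋))) }
    ; reflexive    = ~-reflexive
    ; converse     = λ { (α , β , refl) → β , α , ⊆ᴿ-antisym
                         (λ r → ∋-basis⁺ (~-converse (∋-basis⁻ (∋-ᵀ⁻ (basis α β) r))))
                         (λ r → ∋-ᵀ⁺ (basis α β) (∋-basis⁺ (~-converse (∋-basis⁻ r)))) }
    ; intersection = λ { (_ , _ , refl) (_ , _ , refl) (_ , _ , refl) t∋ t∋′ →
                         let p = ~-trans (~-sym (∋-basis⁻ t∋)) (∋-basis⁻ t∋′) in
                         ℕ.≤-antisym (paths-≤ p) (paths-≤ (~-sym p)) }
    }

  invariant⇒relation : ∀ R → (∀ {α β α′ β′} → R ∋⟨ α , β ⟩ → (α , β) ~ (α′ , β′) → R ∋⟨ α′ , β′ ⟩) →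
                       IsRelationOf configuration R
  invariant⇒relation R invariant = FromCoherent.invariant⇒relation coherent R
    λ {_} {_} {α′} {β′} R∋ eq → invariant R∋ (∋-basis⁻ (subst (_∋⟨ α′ , β′ ⟩) (sym eq) (∋-basis⁺ ~-refl)))

  relation-invariant : ∀ {R α β α′ β′} → IsRelationOf configuration R → R ∋⟨ α , β ⟩ →
                       (α , β) ~ (α′ , β′) → R ∋⟨ α′ , β′ ⟩
  relation-invariant isR R∋ p = FromCoherent.relation-invariant coherent isR R∋ (basis-cong p)

  splits⇒fibers : ∀ {X} → Splits X → IsUnionOfFibers configuration X
  splits⇒fibers {X} splits = map fibre members , All.map⁺ (All.tabulate λ {x} _ → x , x , fibre-diagonal x) ,
    ⊆-antisym X⊆ ⊆X
    where
    members : List (Fin n)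
    members = filter (_∈? X) (allFin n)

    fibre : Fin n → Subset n
    fibre x = ⟦ (λ y → (x , x) ~? (y , y)) ⟧

    fibre-diagonal : ∀ x → diagonal (fibre x) ≡ basis x x
    fibre-diagonal x = ⊆ᴿ-antisym to from
      where
      to : diagonal (fibre x) ⊆ᴿ basis x x
      to d with refl , y∈ ← ∋-diagonal⁻ (fibre x) d = ∋-basis⁺ (∈⟦⟧⁻ (λ y → (x , x) ~? (y , y)) y∈)

      from : basis x x ⊆ᴿ diagonal (fibre x)
      from r with p ← ∋-basis⁻ r with refl ← ~-diagonal p =
        ∋-diagonal⁺ (fibre x) (∈⟦⟧⁺ (λ y → (x , x) ~? (y , y)) p)

    X⊆ : ∀ {x} → x ∈ X → x ∈ ⋃ (map fibre members)
    X⊆ {x} x∈X = ∈-⋃⁺ (lose (∈-map⁺ fibre (∈-filter⁺ (_∈? X) (∈-allFin x) x∈X))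
                            (∈⟦⟧⁺ (λ y → (x , x) ~? (y , y)) ~-refl))

    ⊆X : ∀ {x} → x ∈ ⋃ (map fibre members) → x ∈ X
    ⊆X x∈ with Γ , Γ∈ , x∈Γ ← find (∈-⋃⁻ (map fibre members) x∈) with y , y∈ , refl ← ∈-map⁻ fibre Γ∈ =
      splits (proj₂ (∈-filter⁻ (_∈? X) {xs = allFin n} y∈)) (∈⟦⟧⁻ (λ z → (y , y) ~? (z , z)) x∈Γ)

  refines⇒fission : ∀ {S} → Refines S → IsFission S configuration
  refines⇒fission refines = coherent , λ { (ss , Sss , refl) → invariant⇒relation _ λ R∋ p →
    let s , s∈ss , s∋ = find (∋-⋃ᴿ⁻ ss R∋) in ∋-⋃ᴿ⁺ ss (lose s∈ss (refines s (All.lookup Sss s∈ss) s∋ p)) }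

-- Complete configurations and generalized bases.

discrete : CoherentEquivalence n
discrete = record
  { _~_           = λ (α , β) (α′ , β′) → α ≡ α′ × β ≡ β′
  ; _~?_          = λ (α , β) (α′ , β′) → α ≟ α′ ×-dec β ≟ β′
  ; isEquivalence = record { refl = refl , refl ; sym = λ { (refl , refl) → refl , refl }
                           ; trans = λ { (refl , refl) q → q } }
  ; ~-converse    = swap
  ; ~-diagonal    = λ { (refl , refl) → refl }
  ; ~-paths       = λ { (refl , refl) → id , id , λ _ → (refl , refl) , (refl , refl) }
  }

module _ {S : Configuration n} {Π : Pred (Subset n) 0ℓ} where
  open CoherentEquivalence

  -- The configuration of `E` is one of the competitors for the Π-fission, so the singleton
  -- relations of the complete configuration `S′` are relations of `E`. A class of diagonal pairs
  -- thus has only one member.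
  generalizedBase⇒discrete : IsGeneralizedBase S Π → (E : CoherentEquivalence n) → Refines E S →
                             (∀ {X} → Π X → Splits E X) → Discrete E
  generalizedBase⇒discrete (S′ , ((((coherent′ , _) , _) , smallest)) , complete) E refines splits {α} p
    with s , S′s , s∋ ← IsCoherent.covering coherent′ α α
    with α₀ , β₀ , refl ← complete S′s
    with refl , refl ← ∋-pair⁻ {α = α₀} {β₀} s∋ =
    proj₁ (∋-pair⁻ {α = α} {α} (ToCoherent.relation-invariant E relationE (∋-pair⁺ α α) p))
    where
    splitting : IsSplittingFission S Π (configuration E)
    splitting = ToCoherent.refines⇒fission E refines , λ ΠX → ToCoherent.splits⇒fibers E (splits ΠX)

    relationE : IsRelationOf (configuration E) (pair α α)
    relationE = proj₂ (smallest _ splitting) (FromCoherent.invariant⇒relation coherent′ (pair α α)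
      λ r eq → FromCoherent.basis-invariant coherent′ S′s r eq)

  -- Every relation on the set is a relation of the complete configuration. This configuration is
  -- the smallest splitting fission as soon as all competitors have singleton fibers, because equal
  -- colours then force equal end points.
  discrete⇒generalizedBase : ((E : CoherentEquivalence n) → Refines E S → (∀ {X} → Π X → Splits E X) → Discrete E) →
                             IsGeneralizedBase S Π
  discrete⇒generalizedBase always = configuration discrete ,
    ((ToCoherent.refines⇒fission discrete (λ { _ _ s∋ (refl , refl) → s∋ }) ,
      λ _ → ToCoherent.splits⇒fibers discrete λ { x∈X (refl , _) → x∈X }) ,
     λ S″ ((coherent″ , relations) , fibers) → coherent″ , λ {R} _ →
       let open FromCoherent coherent″
           fibre≡ = always equivalence
             (λ s Ss s∋ eq → relation-invariant {R = s} (relations (s ∷ [] , Ss ∷ [] , ⊆ᴿ-antisym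
               (λ r → ∋-⋃ᴿ⁺ (s ∷ []) (here r)) (λ r → singleton⁻ (∋-⋃ᴿ⁻ (s ∷ []) r)))) s∋ eq)
             (λ ΠX x∈X eq → fibres-invariant (fibers ΠX) x∈X eq)
       in invariant⇒relation R λ {α} {β} {α′} {β′} R∋ eq → subst (R ∋⟨_, β′ ⟩) (fibre≡ (~-source equivalence {α} {β} {α′} {β′} eq))
            (subst (R ∋⟨ α ,_⟩) (fibre≡ (~-target equivalence {α} {β} {α′} {β′} eq)) R∋)) ,
    λ { (α , β , refl) → α , β , refl }
    where
    singleton⁻ : ∀ {P : Pred (Relation n) 0ℓ} {s} → Any P (s ∷ []) → P s
    singleton⁻ (here p) = p

-- Powers of a permutation and automorphisms.

module Powers (f : Fin n → Fin n) (f-injective : Injective _≡_ _≡_ f) where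

  pow : ℕ → Fin n → Fin n
  pow k x = fold x f k

  pow-+ : ∀ i j x → pow (i + j) x ≡ pow i (pow j x)
  pow-+ i j x = fold-+ x f i

  pow-injective : ∀ k → Injective _≡_ _≡_ (pow k)
  pow-injective zero    eq = eq
  pow-injective (suc k) eq = pow-injective k (f-injective eq)

  -- The self-maps of `Fin n` are coded by the numbers below n ^ n, so two powers of `f` coincide,
  -- and the smaller one cancels by injectivity.
  period : ∃ λ p → ∀ x → pow (suc p) x ≡ x
  period with i , j , i<j , eq ← pigeonhole (ℕ.n<1+n (n ^ n)) (λ i → funToFin (pow (toℕ i)))
         with d , i+1+d≡j ← ℕ.m≤n⇒∃[o]m+o≡n i<j = d , λ x → pow-injective (toℕ i) (begin
    pow (toℕ i) (pow (suc d) x)            ≡⟨ pow-+ (toℕ i) (suc d) x ⟨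
    pow (toℕ i + suc d) x                  ≡⟨ cong (λ k → pow k x) (trans (ℕ.+-suc (toℕ i) d) i+1+d≡j) ⟩
    pow (toℕ j) x                          ≡⟨ finToFun-funToFin (pow (toℕ j)) x ⟨
    finToFun (funToFin (pow (toℕ j))) x    ≡⟨ cong (λ g → finToFun g x) eq ⟨
    finToFun (funToFin (pow (toℕ i))) x    ≡⟨ finToFun-funToFin (pow (toℕ i)) x ⟩
    pow (toℕ i) x                          ∎)
    where open ≡-Reasoning

  private
    P : ℕ
    P = suc (proj₁ period)

  pow-multiple : ∀ q x → pow (q * P) x ≡ x
  pow-multiple zero    x = refl
  pow-multiple (suc q) x = trans (pow-+ P (q * P) x) (trans (proj₂ period _) (pow-multiple q x))

  pow-% : ∀ k x → pow (k % P) x ≡ pow k x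
  pow-% k x = begin
    pow (k % P) x                       ≡⟨ cong (pow (k % P)) (pow-multiple (k / P) x) ⟨
    pow (k % P) (pow (k / P * P) x)     ≡⟨ pow-+ (k % P) (k / P * P) x ⟨
    pow (k % P + k / P * P) x           ≡⟨ cong (λ k → pow k x) (m≡m%n+[m/n]*n k P) ⟨
    pow k x                             ∎
    where open ≡-Reasoning

  -- As `f` has period p + 1, the power with exponent k * p inverts the one with exponent k.
  pow-undo : ∀ k x → pow (k * proj₁ period) (pow k x) ≡ x
  pow-undo k x = begin
    pow (k * p) (pow k x)    ≡⟨ pow-+ (k * p) k x ⟨
    pow (k * p + k) x        ≡⟨ cong (λ k → pow k x) (trans (ℕ.+-comm (k * p) k) (sym (ℕ.*-suc k p))) ⟩
    pow (k * P) x            ≡⟨ pow-multiple k x ⟩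
    x                        ∎
    where
    open ≡-Reasoning
    p = proj₁ period

  -- The orbits on pairs of the cyclic group generated by `f`. Decidability rests on reducing
  -- exponents modulo the period.
  orbitEquivalence : CoherentEquivalence n
  orbitEquivalence = record
    { _~_           = λ (α , β) (α′ , β′) → ∃ λ k → pow k α ≡ α′ × pow k β ≡ β′
    ; _~?_          = λ (α , β) (α′ , β′) →
        map′ (λ (i , eqs) → toℕ i , eqs)
             (λ { (k , refl , refl) → fromℕ< (m%n<n k P) , reduce k α , reduce k β })
             (Fin.any? (λ (i : Fin P) → pow (toℕ i) α ≟ α′ ×-dec pow (toℕ i) β ≟ β′))
    ; isEquivalence = record
        { refl  = 0 , refl , refl
        ; sym   = λ { (k , refl , refl) → k * proj₁ period , pow-undo k _ , pow-undo k _ }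
        ; trans = λ { (k , refl , refl) (l , refl , refl) → l + k , pow-+ l k _ , pow-+ l k _ }
        }
    ; ~-converse    = λ (k , eq₁ , eq₂) → k , eq₂ , eq₁
    ; ~-diagonal    = λ { (k , refl , refl) → refl }
    ; ~-paths       = λ { (k , refl , refl) → pow k , pow-injective k , λ γ → (k , refl , refl) , (k , refl , refl) }
    }
    where
    reduce : ∀ k x → pow (toℕ (fromℕ< (m%n<n k P))) x ≡ pow k x
    reduce k x = trans (cong (λ k → pow k x) (toℕ-fromℕ< (m%n<n k P))) (pow-% k x)

Antisymmetric : CoherentEquivalence n → Set
Antisymmetric E = ∀ {x y} → (x , y) ~ (y , x) → x ≡ y
  where open CoherentEquivalence E

record Automorphism (E : CoherentEquivalence n) (f : Fin n → Fin n) : Set where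
  open CoherentEquivalence E
  field
    injective : Injective _≡_ _≡_ f
    preserves : ∀ x y → (x , y) ~ (f x , f y)

  open Powers f injective

  pow-preserves : ∀ k x y → (x , y) ~ (pow k x , pow k y)
  pow-preserves zero    x y = ~-refl
  pow-preserves (suc k) x y = ~-trans (pow-preserves k x y) (preserves _ _)

module _ {E : CoherentEquivalence n} {f : Fin n → Fin n} (automorphism : Automorphism E f) where
  open CoherentEquivalence E
  open Automorphism automorphism
  open Powers f injective

  -- The orbits of the group generated by `f` form a fission of `S` that splits `Π`. The generalized
  -- base makes it discrete, while x and f x lie in one of its fibers.
  automorphism-trivial : ∀ {S Π} → IsGeneralizedBase S Π → Refines S →
                         (∀ {X} → Π X → ∀ {x} → x ∈ X → f x ∈ X) → ∀ x → f x ≡ x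
  automorphism-trivial {Π = Π} base refines stable x =
    sym (generalizedBase⇒discrete base orbitEquivalence orbit-refines orbit-splits (1 , refl , refl))
    where
    open CoherentEquivalence orbitEquivalence using () renaming (Refines to Refinesᶠ; Splits to Splitsᶠ)

    orbit-refines : Refinesᶠ _
    orbit-refines s {α} {β} Ss s∋ (k , refl , refl) = refines s Ss s∋ (pow-preserves k α β)

    orbit-splits : ∀ {X} → Π X → Splitsᶠ X
    orbit-splits {X} ΠX {x} x∈X (k , refl , _) = pow-stable k
      where
      pow-stable : ∀ k → pow k x ∈ X
      pow-stable zero    = x∈X
      pow-stable (suc k) = stable ΠX (pow-stable k)

  -- If f exchanged X and its complement, the period of a point x would be even, say 2h; then f^h
  -- exchanges x and f^h(x), so antisymmetry makes h a period as well, and the descent never ends.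
  automorphism-no-flip : Antisymmetric E → ∀ {X} → (∀ {x} → x ∈ X → f x ∉ X) → (∀ {x} → x ∉ X → f x ∈ X) → ¬ Fin n
  automorphism-no-flip antisymmetric {X} leave enter x =
    no-period (proj₁ period) (<-wellFounded _) (proj₂ period x)
    where
    even-stays : ∀ h {y} → y ∈ X → pow (h * 2) y ∈ X
    even-stays zero    y∈X = y∈X
    even-stays (suc h) y∈X = enter (leave (even-stays h y∈X))

    even-avoids : ∀ h {y} → y ∉ X → pow (h * 2) y ∉ X
    even-avoids zero    y∉X = y∉X
    even-avoids (suc h) y∉X = leave (enter (even-avoids h y∉X))

    no-period-odd : ∀ h → pow (suc (h * 2)) x ≢ x
    no-period-odd h eq with x ∈? X
    ... | yes x∈X = leave (even-stays h x∈X) (subst (_∈ X) (sym eq) x∈X)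
    ... | no  x∉X = x∉X (subst (_∈ X) eq (enter (even-avoids h x∉X)))

    halve : ∀ h → pow (h * 2) x ≡ x → pow h x ≡ x
    halve h eq = sym (antisymmetric (subst (λ y → (x , pow h x) ~ (pow h x , y))
      (trans (sym (pow-+ h h x)) (trans (cong (λ k → pow k x) h+h≡h*2) eq)) (pow-preserves h x (pow h x))))
      where
      h+h≡h*2 : h + h ≡ h * 2
      h+h≡h*2 = trans (cong (h +_) (sym (ℕ.+-identityʳ h))) (ℕ.*-comm 2 h)

    parity : ∀ p → ∃ λ h → p ≡ h * 2 ⊎ p ≡ suc (h * 2)
    parity zero    = 0 , inj₁ refl
    parity (suc p) with parity p
    ... | h , inj₁ refl = h , inj₂ refl
    ... | h , inj₂ refl = suc h , inj₁ refl

    no-period : ∀ p → Acc _<_ (suc p) → pow (suc p) x ≢ x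
    no-period p (acc rec) eq with parity (suc p)
    ... | h , inj₂ refl = no-period-odd h eq
    ... | suc h , inj₁ refl = no-period h (rec (s<s (s≤s (ℕ.m≤m*n h 2)))) (halve (suc h) eq)

-- Tuples

module Tuples (n m : ℕ) where

  infixl 9 _!_ _[_≔_]

  _!_ : Fin (n ^ m) → Fin m → Fin n
  α ! k = finToFun {n} {m} α k

  tuple : (Fin m → Fin n) → Fin (n ^ m)
  tuple = funToFin

  tuple-! : ∀ g k → tuple g ! k ≡ g k
  tuple-! g k = finToFun-funToFin g k

  funToFin-cong : ∀ {m} {g h : Fin m → Fin n} → (∀ k → g k ≡ h k) → funToFin g ≡ funToFin h
  funToFin-cong {zero}  eq = refl
  funToFin-cong {suc m} eq = cong₂ combine (eq zero) (funToFin-cong (eq ∘ suc))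

  !-ext : ∀ {α β} → (∀ k → α ! k ≡ β ! k) → α ≡ β
  !-ext {α} {β} eq = begin
    α              ≡⟨ funToFin-finToFin {m} {n} α ⟨
    tuple (α !_)   ≡⟨ funToFin-cong eq ⟩
    tuple (β !_)   ≡⟨ funToFin-finToFin {m} {n} β ⟩
    β              ∎
    where open ≡-Reasoning

  abstract
    _[_≔_] : Fin (n ^ m) → Fin m → Fin n → Fin (n ^ m)
    α [ j ≔ x ] = tuple (λ k → if does (k ≟ j) then x else α ! k)

    ≔-same : ∀ α j x → α [ j ≔ x ] ! j ≡ x
    ≔-same α j x with eq ← tuple-! (λ k → if does (k ≟ j) then x else α ! k) j with j ≟ j
    ... | yes _   = eq
    ... | no  j≢j = contradiction refl j≢j

    ≔-other : ∀ α {j k} x → k ≢ j → α [ j ≔ x ] ! k ≡ α ! k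
    ≔-other α {j} {k} x k≢j with eq ← tuple-! (λ k → if does (k ≟ j) then x else α ! k) k with k ≟ j
    ... | yes k≡j = contradiction k≡j k≢j
    ... | no  _   = eq

  ≔-injective : ∀ {α j x y} → α [ j ≔ x ] ≡ α [ j ≔ y ] → x ≡ y
  ≔-injective {α} {j} {x} {y} eq = trans (sym (≔-same α j x)) (trans (cong (_! j) eq) (≔-same α j y))

  ≔-unique : ∀ {α β j x} → (∀ k → k ≢ j → β ! k ≡ α ! k) → β ! j ≡ x → β ≡ α [ j ≔ x ]
  ≔-unique {α} {β} {j} {x} off on = !-ext agree
    where
    agree : ∀ k → β ! k ≡ α [ j ≔ x ] ! k
    agree k with k ≟ j
    ... | yes refl = trans on (sym (≔-same α j x))
    ... | no  k≢j  = trans (off k k≢j) (sym (≔-other α x k≢j))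

  ≔-id : ∀ α j {x} → α ! j ≡ x → α ≡ α [ j ≔ x ]
  ≔-id α j = ≔-unique (λ _ _ → refl)

  ≔-parallel : ∀ α {j k} x y → k ≢ j → α [ j ≔ x ] ! k ≡ α [ j ≔ y ] ! k
  ≔-parallel α x y k≢j = trans (≔-other α x k≢j) (sym (≔-other α y k≢j))

-- Fissions of the exponentiation.

RefinesPower : CoherentEquivalence n → PermutationGroup m → CoherentEquivalence (n ^ m) → Set
RefinesPower {n} {m} C L E = ∀ {α β α′ β′} → (α , β) ~ (α′ , β′) →
  ∃ λ l → ∀ k → (α ! k , β ! k) ≈ (α′ ! (element L l ⟨$⟩ʳ k) , β′ ! (element L l ⟨$⟩ʳ k))
  where
  open Tuples n m
  open CoherentEquivalence E using (_~_)
  open CoherentEquivalence C using () renaming (_~_ to _≈_)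

module _ {Y : Configuration n} (coherent : IsCoherent Y) (L : PermutationGroup m) (E : CoherentEquivalence (n ^ m)) where
  open Tuples n m
  open FromCoherent coherent
  open CoherentEquivalence E

  -- The basis relation `s` of the exponentiation through (α , β) contains (α′ , β′) as well, and
  -- membership in one of its shifted products is read off coordinatewise.
  refines-↑ : Refines (Y ↑ L) → RefinesPower equivalence L E
  refines-↑ refines {α} {β} {α′} {β′} p = located
    where
    t : Fin m → Relation n
    t k = colour (α ! k) (β ! k)

    shifted : Fin (order L) → Relation (n ^ m)
    shifted l = permuteRelation n (element L l) (⨂ t)

    ⨂? : ∀ γ δ → Dec (∀ k → t k ∋⟨ γ ! k , δ ! k ⟩)
    ⨂? γ δ = all? (λ k → t k ∋⟨ γ ! k , δ ! k ⟩?)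

    permute-! : ∀ (l : Permutation′ m) γ k → permute n (flip l) γ ! k ≡ γ ! (l ⟨$⟩ʳ k)
    permute-! l γ k = tuple-! (λ i → γ ! (l ⟨$⟩ʳ i)) k

    shifted⁺ : ∀ l {γ δ} → (∀ k → t k ∋⟨ γ ! (element L l ⟨$⟩ʳ k) , δ ! (element L l ⟨$⟩ʳ k) ⟩) → shifted l ∋⟨ γ , δ ⟩
    shifted⁺ l {γ} {δ} h = ∋-relation⁺ (λ γ δ → ⨂ t ∋⟨ permute n (flip (element L l)) γ , permute n (flip (element L l)) δ ⟩?)
      (∋-relation⁺ ⨂? (λ k → subst₂ (t k ∋⟨_,_⟩) (sym (permute-! (element L l) γ k)) (sym (permute-! (element L l) δ k)) (h k)))

    shifted⁻ : ∀ l {γ δ} → shifted l ∋⟨ γ , δ ⟩ → ∀ k → t k ∋⟨ γ ! (element L l ⟨$⟩ʳ k) , δ ! (element L l ⟨$⟩ʳ k) ⟩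
    shifted⁻ l {γ} {δ} h k = subst₂ (t k ∋⟨_,_⟩) (permute-! (element L l) γ k) (permute-! (element L l) δ k)
      (∋-relation⁻ ⨂? (∋-relation⁻ (λ γ δ → ⨂ t ∋⟨ permute n (flip (element L l)) γ , permute n (flip (element L l)) δ ⟩?) h) k)

    s : Relation (n ^ m)
    s = ⋃ᴿ (tabulate shifted)

    s∋αβ : s ∋⟨ α , β ⟩
    s∋αβ with i , i≈id ← PermutationGroup.identity L = ∋-⋃ᴿ⁺ (tabulate shifted) (tabulate⁺ i (shifted⁺ i λ k →
      subst (λ k′ → t k ∋⟨ α ! k′ , β ! k′ ⟩) (sym (i≈id k)) (∋-colour (α ! k) (β ! k))))

    located : ∃ λ l → ∀ k → t k ≡ colour (α′ ! (element L l ⟨$⟩ʳ k)) (β′ ! (element L l ⟨$⟩ʳ k))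
    located with l , h ← tabulate⁻ (∋-⋃ᴿ⁻ (tabulate shifted) (refines s (t , (λ k → colour-basis _ _) , refl) s∋αβ p)) =
      l , λ k → colour-unique (colour-basis _ _) (shifted⁻ l h k)

-- A member Q of Qs stands for the product of the sets Q j; the conditions make these products a
-- generalized base of the exponentiation.
record IsEncoding (C : CoherentEquivalence n) (L : PermutationGroup m) (Qs : List (Fin m → Subset n)) : Set₁ where
  open CoherentEquivalence
  field
    nonempty : ∀ {Q} → Q List.∈ Qs → ∀ j → Nonempty (Q j)
    rigid    : ∀ j (T : CoherentEquivalence n) → (∀ {p q} → _~_ T p q → _~_ C p q) →
               (∀ {Q} → Q List.∈ Qs → Splits T (Q j)) → Discrete T
    Agree    : Rel (Fin m) 0ℓ
    separate : ∀ {j j′ f} → Automorphism C f →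
               (∀ {Q} → Q List.∈ Qs → ∀ x → (x ∈ Q j → f x ∈ Q j′) × (f x ∈ Q j′ → x ∈ Q j)) →
               (∀ x → f x ≡ x) × Agree j j′
    rigidᴸ   : (T : CoherentEquivalence m) →
               (∀ {i j i′ j′} → _~_ T (i , j) (i′ , j′) → ∃ λ l → element L l ⟨$⟩ʳ i ≡ i′ × element L l ⟨$⟩ʳ j ≡ j′) →
               (∀ {i j} → _~_ T (i , i) (j , j) → Agree i j) → Discrete T

SplitsProducts : ∀ n m → CoherentEquivalence (n ^ m) → List (Fin m → Subset n) → Set
SplitsProducts n m E Qs = ∀ {Q} → Q List.∈ Qs → ∀ {α β} → (α , α) ~ (β , β) →
  (∀ k → α ! k ∈ Q k) → (∀ k → β ! k ∈ Q k)
  where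
  open Tuples n m
  open CoherentEquivalence E using (_~_)

-- Lines in the exponentiation and distances to products.

module Exponentiation
  {n m : ℕ} {C : CoherentEquivalence n} (antisymmetric : Antisymmetric C) (L : PermutationGroup m)
  {Qs : List (Fin m → Subset n)} (encoding : IsEncoding C L Qs)
  (E : CoherentEquivalence (n ^ m)) (locate : RefinesPower C L E) (splits : SplitsProducts n m E Qs)
  {x₀ y₀ : Fin n} (x₀≢y₀ : x₀ ≢ y₀)
  where

  open Tuples n m
  open CoherentEquivalence E
  open IsEncoding encoding
  module C = CoherentEquivalence C
  open C using () renaming (_~_ to _≈_)

  other : ∀ (x : Fin n) → ∃ λ z → x ≢ z
  other x with x ≟ x₀
  ... | yes refl = y₀ , x₀≢y₀
  ... | no  x≢x₀ = x₀ , x≢x₀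

  -- Outside direction j the two points agree, and a pair equivalent to a diagonal pair is diagonal;
  -- so the images agree outside the coordinate to which the group element moves j.
  adjacent : ∀ {α j x z β γ} → (α [ j ≔ x ] , α [ j ≔ z ]) ~ (β , γ) →
             ∃ λ j′ → (∀ k → k ≢ j′ → β ! k ≡ γ ! k) × (x , z) ≈ (β ! j′ , γ ! j′)
  adjacent {α} {j} {x} {z} {β} {γ} p = g ⟨$⟩ʳ j , off ,
      subst₂ (λ x z → (x , z) ≈ (β ! (g ⟨$⟩ʳ j) , γ ! (g ⟨$⟩ʳ j))) (≔-same α j x) (≔-same α j z) (located j)
    where
    g = element L (proj₁ (locate p))
    located = proj₂ (locate p)

    off : ∀ k → k ≢ g ⟨$⟩ʳ j → β ! k ≡ γ ! k
    off k k≢gj = subst (λ k → β ! k ≡ γ ! k) (inverseʳ g) (C.~-diagonal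
        (subst (λ x → (x , α [ j ≔ z ] ! k₀) ≈ (β ! (g ⟨$⟩ʳ k₀) , γ ! (g ⟨$⟩ʳ k₀))) (≔-parallel α x z k₀≢j) (located k₀)))
      where
      k₀ = g ⟨$⟩ˡ k

      k₀≢j : k₀ ≢ j
      k₀≢j eq = k≢gj (trans (sym (inverseʳ g)) (cong (g ⟨$⟩ʳ_) eq))

  line-distinct : ∀ {α j x z β j′ x′ z′} → x ≢ z →
                  (α [ j ≔ x ] , α [ j ≔ z ]) ~ (β [ j′ ≔ x′ ] , β [ j′ ≔ z′ ]) → x′ ≢ z′
  line-distinct {β = β} {j′} x≢z p x′≡z′ = x≢z (≔-injective (~-irreflexive p (cong (β [ j′ ≔_]) x′≡z′)))

  -- The direction found by `adjacent` must be j′, since in any other coordinate the two images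
  -- agree while x ≢ z.
  line-colour : ∀ {α j x z β j′ x′ z′} → x ≢ z →
                (α [ j ≔ x ] , α [ j ≔ z ]) ~ (β [ j′ ≔ x′ ] , β [ j′ ≔ z′ ]) → (x , z) ≈ (x′ , z′)
  line-colour {β = β} {j′} {x′} {z′} x≢z p with j″ , _ , q ← adjacent p with j″ ≟ j′
  ... | yes refl  = subst₂ (λ x′ z′ → _ ≈ (x′ , z′)) (≔-same β j″ x′) (≔-same β j″ z′) q
  ... | no  j″≢j′ = contradiction (C.~-irreflexive q (≔-parallel β x′ z′ j″≢j′)) x≢z

  -- The matching of paths stays on the second line: a midpoint off this line would be adjacent to
  -- both ends in directions other than j′, so that the ends would agree in coordinate j′ too.
  transfer : ∀ {α j x z β j′ x′ z′} → x ≢ z →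
             (α [ j ≔ x ] , α [ j ≔ z ]) ~ (β [ j′ ≔ x′ ] , β [ j′ ≔ z′ ]) →
             ∃ λ (π : Fin n → Fin n) → Injective _≡_ _≡_ π ×
             (∀ w → (α [ j ≔ x ] , α [ j ≔ w ]) ~ (β [ j′ ≔ x′ ] , β [ j′ ≔ π w ]) ×
                    (α [ j ≔ w ] , α [ j ≔ z ]) ~ (β [ j′ ≔ π w ] , β [ j′ ≔ z′ ]))
  transfer {α} {j} {x} {z} {β} {j′} {x′} {z′} x≢z p with Π , Π-injective , moves ← ~-paths p = π , π-injective ,
      λ w → subst (λ γ → (α [ j ≔ x ] , α [ j ≔ w ]) ~ (β [ j′ ≔ x′ ] , γ)) (on-line w) (proj₁ (moves (α [ j ≔ w ]))) ,
            subst (λ γ → (α [ j ≔ w ] , α [ j ≔ z ]) ~ (γ , β [ j′ ≔ z′ ])) (on-line w) (proj₂ (moves (α [ j ≔ w ])))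
    where
    π : Fin n → Fin n
    π w = Π (α [ j ≔ w ]) ! j′

    off : ∀ w k → k ≢ j′ → Π (α [ j ≔ w ]) ! k ≡ β ! k
    off w k k≢j′ with q₁ , q₂ ← moves (α [ j ≔ w ]) with w ≟ x | w ≟ z
    ... | yes refl | _ = trans (cong (_! k) (sym (~-diagonal q₁))) (≔-other β x′ k≢j′)
    ... | no _ | yes refl = trans (cong (_! k) (~-diagonal q₂)) (≔-other β z′ k≢j′)
    ... | no _ | no _ with j₁ , off₁ , _ ← adjacent q₁ | j₂ , off₂ , _ ← adjacent q₂
      with j₁ ≟ j′ | j₂ ≟ j′
    ...   | yes refl | _        = trans (sym (off₁ k k≢j′)) (≔-other β x′ k≢j′)
    ...   | no _     | yes refl = trans (off₂ k k≢j′) (≔-other β z′ k≢j′)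
    ...   | no j₁≢j′ | no j₂≢j′ = contradiction
      (trans (sym (≔-same β j′ x′)) (trans (off₁ j′ (≢-sym j₁≢j′)) (trans (off₂ j′ (≢-sym j₂≢j′)) (≔-same β j′ z′))))
      (line-distinct x≢z p)

    on-line : ∀ w → Π (α [ j ≔ w ]) ≡ β [ j′ ≔ π w ]
    on-line w = ≔-unique (off w) refl

    π-injective : Injective _≡_ _≡_ π
    π-injective {v} {w} eq = ≔-injective (Π-injective
      (trans (on-line v) (trans (cong (β [ j′ ≔_]) eq) (sym (on-line w)))))

  differing : ∀ (α β : Fin (n ^ m)) k → Dec (α ! k ≢ β ! k)
  differing α β k = ¬? (α ! k ≟ β ! k)

  distance : Fin (n ^ m) → Fin (n ^ m) → ℕ
  distance α β = ∣ ⟦ differing α β ⟧ ∣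

  -- The group element that matches the coordinates carries differing coordinates to differing ones.
  distance-≤ : ∀ {α β α′ β′} → (α , β) ~ (α′ , β′) → distance α β ≤ distance α′ β′
  distance-≤ {α} {β} {α′} {β′} p = ∣∣-mono-injection (g ⟨$⟩ʳ_)
      (λ {k} k∈ → ∈⟦⟧⁺ (differing α′ β′) (λ eq → ∈⟦⟧⁻ (differing α β) k∈ (C.~-irreflexive (proj₂ (locate p) k) eq)))
      (λ _ _ eq → trans (sym (inverseˡ g)) (trans (cong (g ⟨$⟩ˡ_) eq) (inverseˡ g)))
    where g = element L (proj₁ (locate p))

  module Height (Q : Fin m → Subset n) where

    outside? : ∀ β k → Dec (β ! k ∉ Q k)
    outside? β k = ¬? (β ! k ∈? Q k)

    -- The Hamming distance from β to the product of the sets Q k.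
    height : Fin (n ^ m) → ℕ
    height β = ∣ ⟦ outside? β ⟧ ∣

    outside-mono : ∀ {α j x} → x ∈ Q j → ∀ w {k} → k ∈ ⟦ outside? (α [ j ≔ x ]) ⟧ → k ∈ ⟦ outside? (α [ j ≔ w ]) ⟧
    outside-mono {α} {j} {x} x∈ w {k} k∈ = ∈⟦⟧⁺ (outside? (α [ j ≔ w ])) (shift (∈⟦⟧⁻ (outside? (α [ j ≔ x ])) k∈))
      where
      shift : α [ j ≔ x ] ! k ∉ Q k → α [ j ≔ w ] ! k ∉ Q k
      shift ∉Qk with k ≟ j
      ... | yes refl = contradiction (subst (_∈ Q k) (sym (≔-same α k x)) x∈) ∉Qk
      ... | no  k≢j  = subst (_∉ Q k) (≔-parallel α x w k≢j) ∉Qk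

    -- Along a line in direction j only coordinate j varies, so the height is least at the points of
    -- `Q j` and, by `height-strict`, larger elsewhere.
    height-minimal : ∀ {α j x} → x ∈ Q j → ∀ w → height (α [ j ≔ x ]) ≤ height (α [ j ≔ w ])
    height-minimal x∈ w = p⊆q⇒∣p∣≤∣q∣ (outside-mono x∈ w)

    height-strict : ∀ {α j x w} → x ∈ Q j → w ∉ Q j → height (α [ j ≔ x ]) < height (α [ j ≔ w ])
    height-strict {α} {j} {x} {w} x∈ w∉ = p⊂q⇒∣p∣<∣q∣ (outside-mono x∈ w ,
       j , ∈⟦⟧⁺ (outside? (α [ j ≔ w ])) (subst (_∉ Q j) (sym (≔-same α j w)) w∉) ,
       λ j∈ → ∈⟦⟧⁻ (outside? (α [ j ≔ x ])) j∈ (subst (_∈ Q j) (sym (≔-same α j x)) x∈))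

    module _ (Q∈ : Q List.∈ Qs) where

      nearest : ∀ (β : Fin (n ^ m)) k → Dec (β ! k ∈ Q k) → Fin n
      nearest β k (yes _) = β ! k
      nearest β k (no  _) = proj₁ (nonempty Q∈ k)

      nearest-∈ : ∀ β k d → nearest β k d ∈ Q k
      nearest-∈ β k (yes ∈Qk) = ∈Qk
      nearest-∈ β k (no  _)   = proj₂ (nonempty Q∈ k)

      nearest-≢ : ∀ β k d → β ! k ≢ nearest β k d → β ! k ∉ Q k
      nearest-≢ β k (yes _)   neq = contradiction refl neq
      nearest-≢ β k (no  ∉Qk) neq = ∉Qk

      -- A nearest point of the product: exactly the coordinates outside their factor are changed.
      projection : Fin (n ^ m) → Fin (n ^ m)
      projection β = tuple (λ k → nearest β k (β ! k ∈? Q k))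

      projection-∈ : ∀ β k → projection β ! k ∈ Q k
      projection-∈ β k = subst (_∈ Q k) (sym (tuple-! _ k)) (nearest-∈ β k (β ! k ∈? Q k))

      distance-projection : ∀ β → distance β (projection β) ≤ height β
      distance-projection β = p⊆q⇒∣p∣≤∣q∣ λ {k} k∈ → ∈⟦⟧⁺ (outside? β)
        (nearest-≢ β k (β ! k ∈? Q k) (subst (β ! k ≢_) (tuple-! _ k) (∈⟦⟧⁻ (differing β (projection β)) k∈)))

      height-≤-distance : ∀ β {γ} → (∀ k → γ ! k ∈ Q k) → height β ≤ distance β γ
      height-≤-distance β {γ} γ∈ = p⊆q⇒∣p∣≤∣q∣ λ {k} k∈ → ∈⟦⟧⁺ (differing β γ)
        λ eq → ∈⟦⟧⁻ (outside? β) k∈ (subst (_∈ Q k) (sym eq) (γ∈ k))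

      -- The projection of β is matched with a point that `splits` keeps in the product, and this
      -- point is no farther from β′ than the projection is from β.
      height-≤ : ∀ {β β′} → (β , β) ~ (β′ , β′) → height β′ ≤ height β
      height-≤ {β} {β′} p with Π , _ , moves ← ~-paths p with q , _ ← moves (projection β) = begin
        height β′                       ≤⟨ height-≤-distance β′ (splits Q∈ (~-target q) (projection-∈ β)) ⟩
        distance β′ (Π (projection β))  ≤⟨ distance-≤ (~-sym q) ⟩
        distance β (projection β)       ≤⟨ distance-projection β ⟩
        height β                        ∎
        where open ℕ.≤-Reasoning

      -- If x′ were outside `Q j′`, a point w′ of `Q j′` would have smaller height than x′ on the
      -- second line. Pulled back to the first line it would lie lower than x, against the
      -- minimality of the height at x.
      line-∈ : ∀ {α j x z β j′ x′ z′} → x ≢ z →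
               (α [ j ≔ x ] , α [ j ≔ z ]) ~ (β [ j′ ≔ x′ ] , β [ j′ ≔ z′ ]) → x ∈ Q j → x′ ∈ Q j′
      line-∈ {α} {j} {x} {z} {β} {j′} {x′} x≢z p x∈ with x′ ∈? Q j′
      ... | yes x′∈ = x′∈
      ... | no  x′∉ with w′ , w′∈ ← nonempty Q∈ j′ with π , _ , moves ← transfer (line-distinct x≢z p) (~-sym p) =
        contradiction (begin-strict
          height (α [ j ≔ x ])      ≤⟨ height-minimal x∈ (π w′) ⟩
          height (α [ j ≔ π w′ ])   ≤⟨ height-≤ (~-target (proj₁ (moves w′))) ⟩
          height (β [ j′ ≔ w′ ])    <⟨ height-strict w′∈ x′∉ ⟩
          height (β [ j′ ≔ x′ ])    ≤⟨ height-≤ (~-source p) ⟩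
          height (α [ j ≔ x ])      ∎) (ℕ.<-irrefl refl)
        where open ℕ.≤-Reasoning

  open Height using (line-∈)

  -- The configuration induced on a line.

  module Line (α : Fin (n ^ m)) (j : Fin m) where

    -- Equivalence of two points of the line as points of that line: points equivalent under _~_
    -- need not have similar lines in direction j.
    Similar : Rel (Fin n) 0ℓ
    Similar x x′ = ∃₂ λ z z′ → x ≢ z × (α [ j ≔ x ] , α [ j ≔ z ]) ~ (α [ j ≔ x′ ] , α [ j ≔ z′ ])

    similar? : ∀ x x′ → Dec (Similar x x′)
    similar? x x′ = Fin.any? λ z → Fin.any? λ z′ → ¬? (x ≟ z) ×-dec ((α [ j ≔ x ] , α [ j ≔ z ]) ~? (α [ j ≔ x′ ] , α [ j ≔ z′ ]))

    similar-refl : ∀ x → Similar x x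
    similar-refl x with z , x≢z ← other x = z , z , x≢z , ~-refl

    similar-sym : ∀ {x x′} → Similar x x′ → Similar x′ x
    similar-sym (z , z′ , x≢z , p) = z′ , z , line-distinct x≢z p , ~-sym p

    similar-trans : ∀ {x x′ x″} → Similar x x′ → Similar x′ x″ → Similar x x″
    similar-trans (z , z′ , x≢z , p) (w′ , w″ , x′≢w′ , q)
      with π , _ , moves ← transfer (line-distinct x≢z p) (~-sym p) =
      π w′ , w″ , line-distinct x′≢w′ (proj₁ (moves w′)) , ~-trans (~-sym (proj₁ (moves w′))) q

    similar-target : ∀ {x y x′ y′} → (α [ j ≔ x ] , α [ j ≔ y ]) ~ (α [ j ≔ x′ ] , α [ j ≔ y′ ]) →
                     Similar x x′ → Similar y y′
    similar-target {x} {y} {x′} p s with x ≟ y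
    ... | yes refl = subst (Similar x) (≔-injective (~-diagonal p)) s
    ... | no  x≢y  = x , x′ , ≢-sym x≢y , ~-converse p

    -- The condition `Similar x x′` matters for diagonal pairs, where the other condition says only
    -- that two points of the power lie in one fiber.
    lineEquivalence : CoherentEquivalence n
    lineEquivalence = record
      { _~_           = λ (x , y) (x′ , y′) → (α [ j ≔ x ] , α [ j ≔ y ]) ~ (α [ j ≔ x′ ] , α [ j ≔ y′ ]) × Similar x x′
      ; _~?_          = λ (x , y) (x′ , y′) → ((α [ j ≔ x ] , α [ j ≔ y ]) ~? (α [ j ≔ x′ ] , α [ j ≔ y′ ])) ×-dec similar? x x′
      ; isEquivalence = record
          { refl  = ~-refl , similar-refl _
          ; sym   = λ (p , s) → ~-sym p , similar-sym s
          ; trans = λ (p , s) (q , t) → ~-trans p q , similar-trans s t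
          }
      ; ~-converse    = λ (p , s) → ~-converse p , similar-target p s
      ; ~-diagonal    = λ (p , _) → ≔-injective (~-diagonal p)
      ; ~-paths       = line-paths
      }
      where
      line-paths : ∀ {x y x′ y′} →
        (α [ j ≔ x ] , α [ j ≔ y ]) ~ (α [ j ≔ x′ ] , α [ j ≔ y′ ]) × Similar x x′ →
        ∃ λ (π : Fin n → Fin n) → Injective _≡_ _≡_ π × (∀ w →
          ((α [ j ≔ x ] , α [ j ≔ w ]) ~ (α [ j ≔ x′ ] , α [ j ≔ π w ]) × Similar x x′) ×
          ((α [ j ≔ w ] , α [ j ≔ y ]) ~ (α [ j ≔ π w ] , α [ j ≔ y′ ]) × Similar w (π w)))
      line-paths {x} {y} {x′} {y′} (p , s) with x ≟ y
      ... | no x≢y with π , π-injective , moves ← transfer x≢y p = π , π-injective , λ w →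
        let q₁ , q₂ = moves w in (q₁ , s) , (q₂ , similar-target q₁ s)
      -- A diagonal pair does not span the line; the map comes from the witness of `Similar`, which
      -- does.
      ... | yes refl with z , z′ , x≢z , q ← s with π , π-injective , moves ← transfer x≢z q = π , π-injective , λ w →
        let q₁ , _ = moves w in (q₁ , s) ,
          (subst (λ y′ → (α [ j ≔ w ] , α [ j ≔ x ]) ~ (α [ j ≔ π w ] , α [ j ≔ y′ ])) (≔-injective (~-diagonal p)) (~-converse q₁) ,
           similar-target q₁ s)

    line-finer : ∀ {x y x′ y′} → (α [ j ≔ x ] , α [ j ≔ y ]) ~ (α [ j ≔ x′ ] , α [ j ≔ y′ ]) × Similar x x′ →
                 (x , y) ≈ (x′ , y′)
    line-finer {x} {y} {x′} (p , (z , z′ , x≢z , q)) with x ≟ y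
    ... | no  x≢y  = line-colour x≢y p
    ... | yes refl = subst (λ y′ → (x , x) ≈ (x′ , y′)) (≔-injective (~-diagonal p)) (C.~-source (line-colour x≢z q))

    -- By `line-∈` the induced configuration splits the factors in direction j, so `rigid` applies.
    line-discrete : CoherentEquivalence.Discrete lineEquivalence
    line-discrete = rigid j lineEquivalence line-finer
      λ {Q} Q∈ x∈ (_ , (z , z′ , x≢z , q)) → line-∈ Q Q∈ x≢z q x∈

    line-determined : ∀ {x y y′} → (α [ j ≔ x ] , α [ j ≔ y ]) ~ (α [ j ≔ x ] , α [ j ≔ y′ ]) → y ≡ y′
    line-determined {x} p = line-discrete (~-target p , similar-target p (similar-refl x))

  module _ {α j x z β j′ x′ z′} (x≢z : x ≢ z)
           (p : (α [ j ≔ x ] , α [ j ≔ z ]) ~ (β [ j′ ≔ x′ ] , β [ j′ ≔ z′ ])) where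

    private
      f : Fin n → Fin n
      f = proj₁ (transfer x≢z p)

      f-injective : Injective _≡_ _≡_ f
      f-injective = proj₁ (proj₂ (transfer x≢z p))

      from-x : ∀ w → (α [ j ≔ x ] , α [ j ≔ w ]) ~ (β [ j′ ≔ x′ ] , β [ j′ ≔ f w ])
      from-x w = proj₁ (proj₂ (proj₂ (transfer x≢z p)) w)

      fx≡x′ : f x ≡ x′
      fx≡x′ = sym (≔-injective (~-diagonal (from-x x)))

      fz≡z′ : f z ≡ z′
      fz≡z′ = ≔-injective (~-diagonal (proj₂ (proj₂ (proj₂ (transfer x≢z p)) z)))

      -- `from-x` compares only pairs that start at x. Transferring along (x , w) gives v an image
      -- on the second line, and `line-determined` identifies it with f v.
      preserved : ∀ v w → (α [ j ≔ v ] , α [ j ≔ w ]) ~ (β [ j′ ≔ f v ] , β [ j′ ≔ f w ])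
      preserved v w with x ≟ w
      ... | yes refl = subst (λ y → (α [ j ≔ v ] , α [ j ≔ x ]) ~ (β [ j′ ≔ f v ] , β [ j′ ≔ y ])) (sym fx≡x′) (~-converse (from-x v))
      ... | no  x≢w with π , _ , moves ← transfer x≢w (from-x w) with q₁ , q₂ ← moves v =
        subst (λ y → (α [ j ≔ v ] , α [ j ≔ w ]) ~ (β [ j′ ≔ y ] , β [ j′ ≔ f w ]))
          (Line.line-determined β j′ (~-trans (~-sym q₁) (from-x v))) q₂

      f-preserves : ∀ v w → (v , w) ≈ (f v , f w)
      f-preserves v w with v ≟ w
      ... | no  v≢w  = line-colour v≢w (preserved v w)
      ... | yes refl with u , v≢u ← other v = C.~-source (line-colour v≢u (preserved v u))

      f-∈ : ∀ {Q} → Q List.∈ Qs → ∀ v → (v ∈ Q j → f v ∈ Q j′) × (f v ∈ Q j′ → v ∈ Q j)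
      f-∈ {Q} Q∈ v with u , v≢u ← other v =
        line-∈ Q Q∈ v≢u (preserved v u) , line-∈ Q Q∈ (v≢u ∘ f-injective) (~-sym (preserved v u))

      separated : (∀ v → f v ≡ v) × Agree j j′
      separated = separate (record { injective = f-injective ; preserves = f-preserves }) f-∈

    -- The map `f` between the two lines is an automorphism of `C` that carries each factor at j to
    -- the factor at j′, so `separate` makes it the identity.
    line-rigid : x ≡ x′ × z ≡ z′ × Agree j j′
    line-rigid = trans (sym (proj₁ separated x)) fx≡x′ , trans (sym (proj₁ separated z)) fz≡z′ , proj₂ separated

  -- Fixed points and the coordinate axes.

  Fixed : Fin (n ^ m) → Set
  Fixed α = ∀ {β} → (α , α) ~ (β , β) → α ≡ β

  fixed-anchor : ∀ {α β β′} → Fixed α → (β , β) ~ (β′ , β′) → (β , α) ~ (β′ , α)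
  fixed-anchor {α} {β} {β′} fixed p with Π , _ , moves ← ~-paths p with q , _ ← moves α =
    subst (λ γ → (β , α) ~ (β′ , γ)) (sym (fixed (~-target q))) q

  abstract
    origin : Fin (n ^ m)
    origin = tuple (const x₀)

    origin-! : ∀ k → origin ! k ≡ x₀
    origin-! k = tuple-! (const x₀) k

  origin-≔ : ∀ j → origin ≡ origin [ j ≔ x₀ ]
  origin-≔ j = ≔-id origin j (origin-! j)

  -- If β had a coordinate other than x₀, changing it to x₀ would give a pair equivalent to a pair
  -- on a line through the origin. By `line-rigid` values are preserved, and the origin has the
  -- value x₀ on each of its lines.
  origin-fixed : Fixed origin
  origin-fixed {β} p = !-ext λ j → trans (origin-! j) (sym (value j))
    where
    value : ∀ j → β ! j ≡ x₀
    value j with β ! j ≟ x₀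
    ... | yes eq = eq
    ... | no neq with Π , _ , moves ← ~-paths (~-sym p) with q , _ ← moves (β [ j ≔ x₀ ])
      with q′ ← subst (λ γ → (γ , β [ j ≔ x₀ ]) ~ (origin , Π (β [ j ≔ x₀ ]))) (≔-id β j refl) q
      with j′ , off , _ ← adjacent q′ =
      proj₁ (line-rigid neq (subst₂ (λ γ δ → (β [ j ≔ β ! j ] , β [ j ≔ x₀ ]) ~ (γ , δ))
        (origin-≔ j′) (≔-unique (λ k k≢j′ → sym (off k k≢j′)) refl) q′))

  module Axis {y : Fin n} (y≢x₀ : y ≢ x₀) where

    unit : Fin m → Fin (n ^ m)
    unit j = origin [ j ≔ y ]

    unit-same : ∀ j → unit j ! j ≡ y
    unit-same j = ≔-same origin j y

    unit-other : ∀ {j k} → k ≢ j → unit j ! k ≡ x₀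
    unit-other {k = k} k≢j = trans (≔-other origin y k≢j) (origin-! k)

    unit-injective : Injective _≡_ _≡_ unit
    unit-injective {i} {j} eq with i ≟ j
    ... | yes i≡j = i≡j
    ... | no  i≢j = contradiction (trans (sym (unit-same i)) (trans (cong (_! i) eq) (unit-other i≢j))) y≢x₀

    unit-neighbour : ∀ {j γ} → (unit j , origin) ~ (γ , origin) → ∃ λ j′ → γ ≡ unit j′ × Agree j j′
    unit-neighbour {j} {γ} p
      with p′ ← subst (λ δ → (unit j , δ) ~ (γ , origin)) (origin-≔ j) p
      with j′ , off , _ ← adjacent p′
      with γ≡ ← ≔-unique {origin} {γ} {j′} (λ k k≢j′ → off k k≢j′) refl
      with y≡ , _ , agree ← line-rigid y≢x₀ (subst₂ (λ δ ε → (unit j , origin [ j ≔ x₀ ]) ~ (δ , ε)) γ≡ (origin-≔ j′) p′) =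
      j′ , trans γ≡ (cong (origin [ j′ ≔_]) (sym y≡)) , agree

    unit-image : ∀ {j γ} → (unit j , unit j) ~ (γ , γ) → ∃ λ j′ → γ ≡ unit j′ × Agree j j′
    unit-image p = unit-neighbour (fixed-anchor origin-fixed p)

    -- The set of units is closed under equivalence by `unit-image`, so `E` restricts to it and
    -- matchings of paths send units to units.
    axisEquivalence : CoherentEquivalence m
    axisEquivalence = record
      { _~_           = λ (i , j) (i′ , j′) → (unit i , unit j) ~ (unit i′ , unit j′)
      ; _~?_          = λ (i , j) (i′ , j′) → (unit i , unit j) ~? (unit i′ , unit j′)
      ; isEquivalence = record { refl = ~-refl ; sym = ~-sym ; trans = ~-trans }
      ; ~-converse    = ~-converse
      ; ~-diagonal    = λ p → unit-injective (~-diagonal p)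
      ; ~-paths       = axis-paths
      }
      where
      axis-paths : ∀ {i j i′ j′} → (unit i , unit j) ~ (unit i′ , unit j′) → ∃ λ (π : Fin m → Fin m) →
        Injective _≡_ _≡_ π × (∀ k → (unit i , unit k) ~ (unit i′ , unit (π k)) × (unit k , unit j) ~ (unit (π k) , unit j′))
      axis-paths {i} {j} {i′} {j′} p with Π , Π-injective , moves ← ~-paths p = π , π-injective ,
          λ k → subst (λ γ → (unit i , unit k) ~ (unit i′ , γ)) (Π-unit k) (proj₁ (moves (unit k))) ,
                subst (λ γ → (unit k , unit j) ~ (γ , unit j′)) (Π-unit k) (proj₂ (moves (unit k)))
        where
        π : Fin m → Fin m
        π k = proj₁ (unit-image (~-target (proj₁ (moves (unit k)))))

        Π-unit : ∀ k → Π (unit k) ≡ unit (π k)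
        Π-unit k = proj₁ (proj₂ (unit-image (~-target (proj₁ (moves (unit k))))))

        π-injective : Injective _≡_ _≡_ π
        π-injective {k} {k′} eq = unit-injective (Π-injective (trans (Π-unit k) (trans (cong unit eq) (sym (Π-unit k′)))))

    -- For i ≢ j the two units differ only at i, by (y , x₀), and at j, by (x₀ , y). Antisymmetry
    -- tells these two colours apart.
    locate-unit : ∀ {i j k} → (y , x₀) ≈ (unit i ! k , unit j ! k) → k ≡ i
    locate-unit {i} {j} {k} p with k ≟ i | k ≟ j
    ... | yes k≡i | _        = k≡i
    ... | no  k≢i | no  k≢j  = contradiction (C.~-irreflexive p (trans (unit-other k≢i) (sym (unit-other k≢j)))) y≢x₀
    ... | no  k≢i | yes refl = contradiction
      (antisymmetric (subst₂ (λ a b → (y , x₀) ≈ (a , b)) (unit-other k≢i) (unit-same k) p)) y≢x₀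

    axis-located : ∀ {i j i′ j′} → (unit i , unit j) ~ (unit i′ , unit j′) →
                   ∃ λ l → element L l ⟨$⟩ʳ i ≡ i′ × element L l ⟨$⟩ʳ j ≡ j′
    axis-located {i} {j} {i′} {j′} p with i ≟ j
    ... | no i≢j with l , h ← locate p = l ,
      locate-unit (subst₂ (λ a b → (a , b) ≈ (unit i′ ! (element L l ⟨$⟩ʳ i) , unit j′ ! (element L l ⟨$⟩ʳ i)))
                          (unit-same i) (unit-other i≢j) (h i)) ,
      locate-unit (subst₂ (λ a b → (a , b) ≈ (unit j′ ! (element L l ⟨$⟩ʳ j) , unit i′ ! (element L l ⟨$⟩ʳ j)))
                          (unit-same j) (unit-other (≢-sym i≢j)) (C.~-converse (h j)))
    -- Here the two units coincide and show no direction; the fixed origin takes the place of the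
    -- second unit.
    ... | yes refl with refl ← unit-injective (~-diagonal p) = l , moved , moved
      where
      l = proj₁ (locate (fixed-anchor origin-fixed p))
      h = proj₂ (locate (fixed-anchor origin-fixed p))

      moved : element L l ⟨$⟩ʳ i ≡ i′
      moved with element L l ⟨$⟩ʳ i ≟ i′
      ... | yes eq = eq
      ... | no neq = contradiction
        (trans (sym (unit-same i)) (trans (C.~-irreflexive (h i) (trans (unit-other neq) (sym (origin-! _)))) (origin-! i))) y≢x₀

    axis-discrete : CoherentEquivalence.Discrete axisEquivalence
    axis-discrete = rigidᴸ axisEquivalence axis-located agree
      where
      agree : ∀ {i j} → (unit i , unit i) ~ (unit j , unit j) → Agree i j
      agree {i} p = let _ , eq , a = unit-image p in subst (Agree i) (sym (unit-injective eq)) a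

    unit-fixed : ∀ j → Fixed (unit j)
    unit-fixed j {β} p = let j′ , β≡ , _ = unit-image p in
      trans (cong unit (axis-discrete (subst (λ β → (unit j , unit j) ~ (β , β)) β≡ p))) (sym β≡)

  -- With y = β ! j, the point β is closer to `unit j` than to the origin. Both are fixed, so β′ has
  -- the same distances to them, which requires β′ ! j ≡ β ! j.
  determined : ∀ {β β′} → (β , β) ~ (β′ , β′) → ∀ j → β ! j ≢ x₀ → β ! j ≡ β′ ! j
  determined {β} {β′} p j β≢x₀ with β′ ! j ≟ β ! j
  ... | yes eq = sym eq
  ... | no neq = contradiction (begin-strict
      distance β (unit j)    <⟨ closer ⟩
      distance β origin      ≤⟨ distance-≤ (fixed-anchor origin-fixed p) ⟩
      distance β′ origin     ≤⟨ not-closer ⟩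
      distance β′ (unit j)   ≤⟨ distance-≤ (~-sym (fixed-anchor (unit-fixed j) p)) ⟩
      distance β (unit j)    ∎) (ℕ.<-irrefl refl)
    where
    open ℕ.≤-Reasoning
    open Axis β≢x₀

    keep : ∀ k → β ! k ≢ unit j ! k → β ! k ≢ origin ! k
    keep k neq′ with k ≟ j
    ... | yes refl = contradiction (sym (unit-same k)) neq′
    ... | no  k≢j  = subst (β ! k ≢_) (≔-other origin (β ! j) k≢j) neq′

    closer : distance β (unit j) < distance β origin
    closer = p⊂q⇒∣p∣<∣q∣
      ((λ {k} k∈ → ∈⟦⟧⁺ (differing β origin) (keep k (∈⟦⟧⁻ (differing β (unit j)) k∈))) ,
       j , ∈⟦⟧⁺ (differing β origin) (λ eq → β≢x₀ (trans eq (origin-! j))) ,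
       λ j∈ → ∈⟦⟧⁻ (differing β (unit j)) j∈ (sym (unit-same j)))

    keep′ : ∀ k → β′ ! k ≢ origin ! k → β′ ! k ≢ unit j ! k
    keep′ k neq′ with k ≟ j
    ... | yes refl = λ eq → neq (trans eq (unit-same k))
    ... | no  k≢j  = subst (β′ ! k ≢_) (sym (≔-other origin (β ! j) k≢j)) neq′

    not-closer : distance β′ origin ≤ distance β′ (unit j)
    not-closer = p⊆q⇒∣p∣≤∣q∣ λ {k} k∈ → ∈⟦⟧⁺ (differing β′ (unit j)) (keep′ k (∈⟦⟧⁻ (differing β′ origin) k∈))

  exponentiation-discrete : Discrete
  exponentiation-discrete {β} {β′} p = !-ext agree
    where
    agree : ∀ j → β ! j ≡ β′ ! j
    agree j with β ! j ≟ x₀ | β′ ! j ≟ x₀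
    ... | no  neq | _       = determined p j neq
    ... | yes _   | no  neq = sym (determined (~-sym p) j neq)
    ... | yes eq  | yes eq′ = trans eq (sym eq′)

-- A criterion for generalized bases of the exponentiation.

module _ {Y : Configuration n} (coherent : IsCoherent Y) where
  open FromCoherent coherent

  antisymmetric-equivalence : IsAntisymmetric Y → Antisymmetric equivalence
  antisymmetric-equivalence antisymmetric {x} {y} eq =
    proj₁ (∋-diagonal⁻ _ (antisymmetric (colour-basis x y) symmetric (∋-colour x y)))
    where
    symmetric : colour x y ≡ colour x y ᵀ
    symmetric = sym (colour-unique (IsCoherent.converse coherent (colour-basis x y)) (∋-ᵀ⁺ (colour x y) (∋-colour-≡ eq)))

  equivalence-refines : CoherentEquivalence.Refines equivalence Y
  equivalence-refines s = basis-invariant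

  finer-refines : (T : CoherentEquivalence n) →
                  (∀ {p q} → CoherentEquivalence._~_ T p q → CoherentEquivalence._~_ equivalence p q) →
                  CoherentEquivalence.Refines T Y
  finer-refines T finer s Ss s∋ p = basis-invariant Ss s∋ (finer p)

module _ (L : PermutationGroup m) (T : CoherentEquivalence m) where
  open CoherentEquivalence T

  -- `T` moves pairs only by elements of `L`, and orbits absorb these since `L` is closed under
  -- composition.
  refines-Inv : (∀ {i j i′ j′} → (i , j) ~ (i′ , j′) → ∃ λ l → element L l ⟨$⟩ʳ i ≡ i′ × element L l ⟨$⟩ʳ j ≡ j′) →
                Refines (Inv L)
  refines-Inv located s (i , j , refl) s∋ p
    with l , s∋l ← tabulate⁻ (∋-⋃ᴿ⁻ (tabulate λ l → pair (element L l ⟨$⟩ʳ i) (element L l ⟨$⟩ʳ j)) s∋)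
    with refl , refl ← ∋-pair⁻ {α = element L l ⟨$⟩ʳ i} {element L l ⟨$⟩ʳ j} s∋l
    with l′ , refl , refl ← located p
    with l″ , l″≈ ← PermutationGroup.composite L l l′ =
    ∋-⋃ᴿ⁺ (tabulate λ l → pair (element L l ⟨$⟩ʳ i) (element L l ⟨$⟩ʳ j)) (tabulate⁺ l″
      (subst₂ (λ a b → pair (element L l″ ⟨$⟩ʳ i) (element L l″ ⟨$⟩ʳ j) ∋⟨ a , b ⟩) (l″≈ i) (l″≈ j) (∋-pair⁺ _ _)))

IsProduct : ∀ n m → (Fin m → Subset n) → Pred (Subset (n ^ m)) 0ℓ
IsProduct n m Q Z = ∀ α → (α ∈ Z → ∀ k → α ! k ∈ Q k) × ((∀ k → α ! k ∈ Q k) → α ∈ Z)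
  where open Tuples n m

encoding⇒generalizedBase :
  ∀ {Y : Configuration n} (coherent : IsCoherent Y) → IsAntisymmetric Y → (L : PermutationGroup m) →
  ∀ {Qs} → IsEncoding (FromCoherent.equivalence coherent) L Qs → ∀ {x₀ y₀ : Fin n} → x₀ ≢ y₀ →
  ∀ {Π} → (∀ {Q} → Q List.∈ Qs → ∃ λ Z → Π Z × IsProduct n m Q Z) → IsGeneralizedBase (Y ↑ L) Π
encoding⇒generalizedBase coherent antisymmetric L encoding x₀≢y₀ products =
  discrete⇒generalizedBase λ E refines splits → Exponentiation.exponentiation-discrete
    (antisymmetric-equivalence coherent antisymmetric) L encoding E (refines-↑ coherent L E refines)
    (λ Q∈ {α} {β} p α∈ → let Z , ΠZ , product = products Q∈ in
      proj₁ (product β) (splits ΠZ (proj₂ (product α) α∈) p))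
    x₀≢y₀

-- Generalized bases: in the coordinates outside D, the set X is replaced by its complement.

flipBy : Subset n → Subset m → Fin m → Subset n
flipBy X D j = if does (j ∈? D) then X else ∁ X

-- When j and j′ lie on the same side of `D`, both sets are `X` or both are its complement; in the
-- second case the converse implication is contraposed.
flipBy-∈ : ∀ {X : Subset n} {D : Subset m} {j j′ x y} → (j ∈ D → j′ ∈ D) → (j′ ∈ D → j ∈ D) →
           (x ∈ flipBy X D j → y ∈ flipBy X D j′) → (y ∈ flipBy X D j′ → x ∈ flipBy X D j) → x ∈ X → y ∈ X
flipBy-∈ {D = D} {j} {j′} j⇒j′ j′⇒j to from x∈X with j ∈? D | j′ ∈? D
... | yes _   | yes _    = to x∈X
... | yes j∈D | no  j′∉D = contradiction (j⇒j′ j∈D) j′∉D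
... | no  j∉D | yes j′∈D = contradiction (j′⇒j j′∈D) j∉D
... | no  _   | no  _    = x∉∁p⇒x∈p λ y∈∁X → x∈∁p⇒x∉p (from y∈∁X) x∈X

-- On different sides of `D` the map `f` would exchange `X` and its complement, which
-- `automorphism-no-flip` excludes.
flipBy-agree : ∀ {C : CoherentEquivalence n} {f} → Antisymmetric C → Automorphism C f → Fin n →
               ∀ {X : Subset n} {D : Subset m} {j j′} →
               (∀ x → (x ∈ flipBy X D j → f x ∈ flipBy X D j′) × (f x ∈ flipBy X D j′ → x ∈ flipBy X D j)) →
               (j ∈ D → j′ ∈ D) × (j′ ∈ D → j ∈ D)
flipBy-agree antisymmetric automorphism x₀ {X} {D} {j} {j′} moves with j ∈? D | j′ ∈? D
... | yes j∈D | yes j′∈D = (λ _ → j′∈D) , (λ _ → j∈D)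
... | no  j∉D | no  j′∉D = (λ j∈D → contradiction j∈D j∉D) , (λ j′∈D → contradiction j′∈D j′∉D)
... | yes _   | no  _    = contradiction x₀ (automorphism-no-flip automorphism antisymmetric
  (λ {x} x∈X → x∈∁p⇒x∉p (proj₁ (moves x) x∈X))
  (λ {x} x∉X → x∉∁p⇒x∈p (λ fx∈∁X → x∉X (proj₂ (moves x) fx∈∁X))))
... | no  _   | yes _    = contradiction x₀ (automorphism-no-flip automorphism antisymmetric
  (λ {x} x∈X fx∈X → x∈∁p⇒x∉p (proj₂ (moves x) fx∈X) x∈X)
  (λ {x} x∉X → proj₁ (moves x) (x∉p⇒x∈∁p x∉X)))

Proper : Pred (Subset n) 0ℓ
Proper X = Nonempty X × Nonempty (∁ X)

flipBy-nonempty : ∀ {X : Subset n} {D : Subset m} → Proper X → ∀ j → Nonempty (flipBy X D j)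
flipBy-nonempty {D = D} (nonempty , nonempty∁) j with j ∈? D
... | yes _ = nonempty
... | no  _ = nonempty∁

module SetEncoding {x₀ y₀ : Fin n} (x₀≢y₀ : x₀ ≢ y₀) where

  singleton-proper : Proper ⁅ x₀ ⁆
  singleton-proper = (x₀ , x∈⁅x⁆ x₀) , (y₀ , x∉p⇒x∈∁p (λ y₀∈ → x₀≢y₀ (sym (x∈⁅y⁆⇒x≡y x₀ y₀∈))))

  -- An empty or full set could yield an empty factor. Replacing it by `⁅ x₀ ⁆` loses nothing, since
  -- every configuration splits the empty and the full set.
  proper : Subset n → Subset n
  proper X with nonempty? X | nonempty? (∁ X)
  ... | yes _ | yes _ = X
  ... | _     | _     = ⁅ x₀ ⁆

  proper-Proper : ∀ X → Proper (proper X)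
  proper-Proper X with nonempty? X | nonempty? (∁ X)
  ... | yes nonempty | yes nonempty∁ = nonempty , nonempty∁
  ... | yes _        | no  _         = singleton-proper
  ... | no  _        | yes _         = singleton-proper
  ... | no  _        | no  _         = singleton-proper

  proper-∈ : ∀ {X x y} → (x ∈ proper X → y ∈ proper X) → x ∈ X → y ∈ X
  proper-∈ {X} {x} {y} to x∈X with nonempty? X | nonempty? (∁ X)
  ... | yes _      | yes _     = to x∈X
  ... | no  empty  | _         = contradiction (x , x∈X) empty
  ... | yes _      | no empty∁ = x∉∁p⇒x∈p λ y∈∁X → empty∁ (y , y∈∁X)

  -- The shorter list is padded, so that the length is the maximum: a missing X by a singleton, a
  -- missing D by the empty set, which puts the complement of X into every coordinate.
  align : List (Subset n) → List (Subset m) → List (Subset n × Subset m)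
  align []       []       = []
  align []       (D ∷ Ds) = (⁅ x₀ ⁆ , D) ∷ align [] Ds
  align (X ∷ Xs) []       = (proper X , ⊥) ∷ align Xs []
  align (X ∷ Xs) (D ∷ Ds) = (proper X , D) ∷ align Xs Ds

  length-align : ∀ Xs (Ds : List (Subset m)) → length (align Xs Ds) ≡ length Xs ⊔ length Ds
  length-align []       []       = refl
  length-align []       (D ∷ Ds) = cong suc (length-align [] Ds)
  length-align (X ∷ Xs) []       = cong suc (trans (length-align Xs []) (ℕ.⊔-identityʳ _))
  length-align (X ∷ Xs) (D ∷ Ds) = cong suc (length-align Xs Ds)

  align-Proper : ∀ Xs (Ds : List (Subset m)) {X D} → (X , D) List.∈ align Xs Ds → Proper X
  align-Proper []       (D ∷ Ds) (here refl) = singleton-proper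
  align-Proper []       (D ∷ Ds) (there ∈)   = align-Proper [] Ds ∈
  align-Proper (X ∷ Xs) []       (here refl) = proper-Proper X
  align-Proper (X ∷ Xs) []       (there ∈)   = align-Proper Xs [] ∈
  align-Proper (X ∷ Xs) (D ∷ Ds) (here refl) = proper-Proper X
  align-Proper (X ∷ Xs) (D ∷ Ds) (there ∈)   = align-Proper Xs Ds ∈

  align-∈ˡ : ∀ {Xs} {Ds : List (Subset m)} {X} → X List.∈ Xs → ∃ λ D → (proper X , D) List.∈ align Xs Ds
  align-∈ˡ {Ds = []}     (here refl) = ⊥ , here refl
  align-∈ˡ {Ds = D ∷ _}  (here refl) = D , here refl
  align-∈ˡ {Ds = []}     (there X∈)  = let D , ∈ = align-∈ˡ X∈ in D , there ∈
  align-∈ˡ {Ds = _ ∷ _}  (there X∈)  = let D , ∈ = align-∈ˡ X∈ in D , there ∈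

  align-∈ʳ : ∀ {Xs} {Ds : List (Subset m)} {D} → D List.∈ Ds → ∃ λ X → (X , D) List.∈ align Xs Ds
  align-∈ʳ {Xs = []}     (here refl) = ⁅ x₀ ⁆ , here refl
  align-∈ʳ {Xs = X ∷ _}  (here refl) = proper X , here refl
  align-∈ʳ {Xs = []}     (there D∈)  = let X , ∈ = align-∈ʳ D∈ in X , there ∈
  align-∈ʳ {Xs = _ ∷ _}  (there D∈)  = let X , ∈ = align-∈ʳ D∈ in X , there ∈

  setEncoding : ∀ {Y : Configuration n} (coherent : IsCoherent Y) → IsAntisymmetric Y → (L : PermutationGroup m) →
                ∀ {Xs Ds} → IsGeneralizedBase Y (List._∈ Xs) → IsGeneralizedBase (Inv L) (List._∈ Ds) →
                IsEncoding (FromCoherent.equivalence coherent) L (map (uncurry flipBy) (align Xs Ds))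
  setEncoding {m} coherent antisymmetric L {Xs} {Ds} baseY baseL = record
    { nonempty = nonempty
    ; rigid    = λ j T finer splits → generalizedBase⇒discrete baseY T (finer-refines coherent T finer)
                   λ X∈ → rigid-splits j T splits X∈
    ; Agree    = λ i j → ∀ {D} → D List.∈ Ds → i ∈ D → j ∈ D
    ; separate = separate
    ; rigidᴸ   = λ T located agree → generalizedBase⇒discrete baseL T (refines-Inv L T located)
                   λ D∈ x∈ p → agree p D∈ x∈
    }
    where
    C = FromCoherent.equivalence coherent

    Qs : List (Fin m → Subset n)
    Qs = map (uncurry flipBy) (align Xs Ds)

    flipBy∈Qs : ∀ {X D} → (X , D) List.∈ align Xs Ds → flipBy X D List.∈ Qs
    flipBy∈Qs = ∈-map⁺ (uncurry flipBy)

    nonempty : ∀ {Q} → Q List.∈ Qs → ∀ j → Nonempty (Q j)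
    nonempty Q∈ j with (X , D) , ∈ , refl ← ∈-map⁻ (uncurry flipBy) Q∈ =
      flipBy-nonempty {X = X} {D} (align-Proper Xs Ds ∈) j

    rigid-splits : ∀ j T → (∀ {Q} → Q List.∈ Qs → CoherentEquivalence.Splits T (Q j)) →
                   ∀ {X} → X List.∈ Xs → CoherentEquivalence.Splits T X
    rigid-splits j T splits {X} X∈ x∈ p with D , ∈ ← align-∈ˡ {Ds = Ds} X∈ = proper-∈ {X}
      (flipBy-∈ {D = D} {j} {j} id id (λ x∈ → splits (flipBy∈Qs ∈) x∈ p)
        (λ y∈ → splits (flipBy∈Qs ∈) y∈ (CoherentEquivalence.~-sym T p))) x∈

    separate : ∀ {j j′ f} → Automorphism C f →
               (∀ {Q} → Q List.∈ Qs → ∀ x → (x ∈ Q j → f x ∈ Q j′) × (f x ∈ Q j′ → x ∈ Q j)) →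
               (∀ x → f x ≡ x) × (∀ {D} → D List.∈ Ds → j ∈ D → j′ ∈ D)
    separate {j} {j′} {f} automorphism moves =
      automorphism-trivial automorphism baseY (equivalence-refines coherent) stable ,
      λ D∈ → let X , ∈ = align-∈ʳ {Xs = Xs} D∈ in proj₁ (agree ∈)
      where
      agree : ∀ {X D} → (X , D) List.∈ align Xs Ds → (j ∈ D → j′ ∈ D) × (j′ ∈ D → j ∈ D)
      agree {X} {D} ∈ = flipBy-agree (antisymmetric-equivalence coherent antisymmetric) automorphism x₀ {X} {D}
        (moves (flipBy∈Qs ∈))

      stable : ∀ {X} → X List.∈ Xs → ∀ {x} → x ∈ X → f x ∈ X
      stable {X} X∈ {x} with D , ∈ ← align-∈ˡ {Ds = Ds} X∈ = proper-∈ {X}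
        (flipBy-∈ {D = D} {j} {j′} (proj₁ (agree ∈)) (proj₂ (agree ∈)) (proj₁ (moves (flipBy∈Qs ∈) x)) (proj₂ (moves (flipBy∈Qs ∈) x)))

-- Bases: two points x, y of a base of Y are exchanged in the coordinates outside D.

choose : Fin n → Fin n → Subset m → Fin m → Fin n
choose x y D j = if does (j ∈? D) then x else y

module PointEncoding {x₀ y₀ : Fin n} (x₀≢y₀ : x₀ ≢ y₀) where

  -- Two base points encode one set D in two tuples, and both points occur in every coordinate. Base
  -- points left over give constant tuples. A set left over takes a single tuple with values x₀ and
  -- y₀, because the base points already force the map between lines to be the identity.
  columns : List (Fin n) → List (Subset m) → List (Fin m → Fin n)
  columns (x ∷ y ∷ xs) (D ∷ Ds) = choose x y D ∷ choose y x D ∷ columns xs Ds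
  columns (x ∷ y ∷ xs) []       = (λ _ → x) ∷ (λ _ → y) ∷ columns xs []
  columns (x ∷ [])     Ds       = (λ _ → x) ∷ columns [] Ds
  columns []           (D ∷ Ds) = choose x₀ y₀ D ∷ columns [] Ds
  columns []           []       = []

  -- With a base of size l, up to ⌊ l /2⌋ sets cost no extra tuple, and ⌊ l /2⌋ equals ⌈ l ∸ 1 /2⌉.
  length-columns : ∀ xs (Ds : List (Subset m)) →
                   length (columns xs Ds) ≡ length xs + (length Ds ∸ ⌈ length xs ∸ 1 /2⌉)
  length-columns []           []       = refl
  length-columns []           (D ∷ Ds) = cong suc (length-columns [] Ds)
  length-columns (x ∷ [])     Ds       = cong suc (length-columns [] Ds)
  length-columns (x ∷ y ∷ xs) []       = cong (2 +_) (trans (length-columns xs [])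
    (cong (length xs +_) (trans (ℕ.0∸n≡0 ⌈ length xs ∸ 1 /2⌉) (sym (ℕ.0∸n≡0 ⌈ suc (length xs) /2⌉)))))
  length-columns (x ∷ y ∷ xs) (D ∷ Ds) = cong (2 +_) (trans (length-columns xs Ds)
    (cong (λ h → length xs + (length Ds ∸ h)) (⌈n∸1/2⌉≡⌊n/2⌋ (length xs))))
    where
    ⌈n∸1/2⌉≡⌊n/2⌋ : ∀ n → ⌈ n ∸ 1 /2⌉ ≡ ⌊ n /2⌋
    ⌈n∸1/2⌉≡⌊n/2⌋ zero    = refl
    ⌈n∸1/2⌉≡⌊n/2⌋ (suc n) = refl

  columns-∈ : ∀ {xs} (Ds : List (Subset m)) {x} → x List.∈ xs → ∀ j → ∃ λ q → q List.∈ columns xs Ds × q j ≡ x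
  columns-∈ {xs = x ∷ []}     Ds (here refl) j = _ , here refl , refl
  columns-∈ {xs = x ∷ y ∷ xs} [] (here refl) j = _ , here refl , refl
  columns-∈ {xs = x ∷ y ∷ xs} [] (there (here refl)) j = _ , there (here refl) , refl
  columns-∈ {xs = x ∷ y ∷ xs} [] (there (there x∈)) j =
    let q , q∈ , eq = columns-∈ [] x∈ j in q , there (there q∈) , eq
  columns-∈ {xs = x ∷ y ∷ xs} (D ∷ Ds) (there (there x∈)) j =
    let q , q∈ , eq = columns-∈ Ds x∈ j in q , there (there q∈) , eq
  columns-∈ {xs = x ∷ y ∷ xs} (D ∷ Ds) (here refl) j with j ∈? D in eq
  ... | yes _ = choose x y D , here refl , cong (if_then x else y) (cong does eq)
  ... | no  _ = choose y x D , there (here refl) , cong (if_then y else x) (cong does eq)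
  columns-∈ {xs = x ∷ y ∷ xs} (D ∷ Ds) (there (here refl)) j with j ∈? D in eq
  ... | yes _ = choose y x D , there (here refl) , cong (if_then y else x) (cong does eq)
  ... | no  _ = choose x y D , here refl , cong (if_then x else y) (cong does eq)

  -- On different sides of `D` the map `f` would exchange x and y, making (x , y) and (y , x)
  -- equivalent, against antisymmetry.
  choose-fixed : ∀ {C : CoherentEquivalence n} {f} → Antisymmetric C → Automorphism C f →
                 ∀ {x y} {D : Subset m} {j j′} → x ≢ y →
                 f (choose x y D j) ≡ choose x y D j′ → f (choose y x D j) ≡ choose y x D j′ → f x ≡ x × f y ≡ y
  choose-fixed {C = C} {f} antisymmetric automorphism {x} {y} {D} {j} {j′} x≢y eq₁ eq₂ with j ∈? D | j′ ∈? D
  ... | yes _ | yes _ = eq₁ , eq₂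
  ... | no  _ | no  _ = eq₂ , eq₁
  ... | yes _ | no  _ = contradiction (antisymmetric (subst₂ (λ a b → CoherentEquivalence._~_ C (x , y) (a , b)) eq₁ eq₂
                          (Automorphism.preserves automorphism x y))) x≢y
  ... | no  _ | yes _ = contradiction (antisymmetric (subst₂ (λ a b → CoherentEquivalence._~_ C (x , y) (a , b)) eq₂ eq₁
                          (Automorphism.preserves automorphism x y))) x≢y

  columns-fixed : ∀ {C : CoherentEquivalence n} {f} → Antisymmetric C → Automorphism C f → ∀ {j j′} xs (Ds : List (Subset m)) →
                  Unique xs → (∀ {q} → q List.∈ columns xs Ds → f (q j) ≡ q j′) → ∀ {x} → x List.∈ xs → f x ≡ x
  columns-fixed a f (x ∷ []) Ds _ moves (here refl) = moves (here refl)
  columns-fixed a f (x ∷ y ∷ xs) [] _ moves (here refl) = moves (here refl)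
  columns-fixed a f (x ∷ y ∷ xs) [] _ moves (there (here refl)) = moves (there (here refl))
  columns-fixed a f (x ∷ y ∷ xs) [] (_ ∷ _ ∷ u) moves (there (there x∈)) =
    columns-fixed a f xs [] u (λ q∈ → moves (there (there q∈))) x∈
  columns-fixed a f {j} {j′} (x ∷ y ∷ xs) (D ∷ Ds) ((x≢y ∷ _) ∷ _) moves (here refl) =
    proj₁ (choose-fixed a f {D = D} {j} {j′} x≢y (moves (here refl)) (moves (there (here refl))))
  columns-fixed a f {j} {j′} (x ∷ y ∷ xs) (D ∷ Ds) ((x≢y ∷ _) ∷ _) moves (there (here refl)) =
    proj₂ (choose-fixed a f {D = D} {j} {j′} x≢y (moves (here refl)) (moves (there (here refl))))
  columns-fixed a f (x ∷ y ∷ xs) (D ∷ Ds) (_ ∷ _ ∷ u) moves (there (there x∈)) =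
    columns-fixed a f xs Ds u (λ q∈ → moves (there (there q∈))) x∈

  choose-agree : ∀ {x y : Fin n} {D : Subset m} {j j′} → x ≢ y → choose x y D j ≡ choose x y D j′ → j ∈ D → j′ ∈ D
  choose-agree {D = D} {j} {j′} x≢y eq j∈D with j ∈? D | j′ ∈? D
  ... | _       | yes j′∈D = j′∈D
  ... | yes _   | no  _    = contradiction eq x≢y
  ... | no  j∉D | no  _    = contradiction j∈D j∉D

  -- Applied once `f` is known to be the identity: coordinates j and j′ of each tuple then coincide,
  -- and the two distinct values in a tuple tell the sides of D apart.
  columns-agree : ∀ {j j′} xs (Ds : List (Subset m)) → Unique xs → (∀ {q} → q List.∈ columns xs Ds → q j ≡ q j′) →
                  ∀ {D} → D List.∈ Ds → j ∈ D → j′ ∈ D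
  columns-agree [] (D ∷ Ds) u same (here refl) = choose-agree x₀≢y₀ (same (here refl))
  columns-agree [] (D ∷ Ds) u same (there D∈)  = columns-agree [] Ds u (same ∘ there) D∈
  columns-agree (x ∷ []) Ds u same D∈ = columns-agree [] Ds [] (same ∘ there) D∈
  columns-agree (x ∷ y ∷ xs) (D ∷ Ds) ((x≢y ∷ _) ∷ _) same (here refl) = choose-agree x≢y (same (here refl))
  columns-agree (x ∷ y ∷ xs) (D ∷ Ds) (_ ∷ _ ∷ u) same (there D∈) = columns-agree xs Ds u (λ q∈ → same (there (there q∈))) D∈

  pointEncoding : ∀ {Y : Configuration n} (coherent : IsCoherent Y) → IsAntisymmetric Y → (L : PermutationGroup m) →
                  ∀ {B xs Ds} → (∀ {x} → x ∈ B → x List.∈ xs) → Unique xs →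
                  IsBase Y B → IsGeneralizedBase (Inv L) (List._∈ Ds) →
                  IsEncoding (FromCoherent.equivalence coherent) L (map (⁅_⁆ ∘_) (columns xs Ds))
  pointEncoding {m} coherent antisymmetric L {B} {xs} {Ds} B⊆xs unique baseY baseL = record
    { nonempty = nonempty
    ; rigid    = λ j T finer splits → generalizedBase⇒discrete baseY T (finer-refines coherent T finer)
                   (rigid-splits j T splits)
    ; Agree    = λ i j → ∀ {D} → D List.∈ Ds → i ∈ D → j ∈ D
    ; separate = separate
    ; rigidᴸ   = λ T located agree → generalizedBase⇒discrete baseL T (refines-Inv L T located)
                   λ D∈ x∈ p → agree p D∈ x∈
    }
    where
    C = FromCoherent.equivalence coherent

    Qs : List (Fin m → Subset n)
    Qs = map (⁅_⁆ ∘_) (columns xs Ds)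

    nonempty : ∀ {Q} → Q List.∈ Qs → ∀ j → Nonempty (Q j)
    nonempty Q∈ j with q , _ , refl ← ∈-map⁻ (⁅_⁆ ∘_) Q∈ = q j , x∈⁅x⁆ (q j)

    rigid-splits : ∀ j T → (∀ {Q} → Q List.∈ Qs → CoherentEquivalence.Splits T (Q j)) →
                   ∀ {X} → singletons B X → CoherentEquivalence.Splits T X
    rigid-splits j T splits (β , β∈B , refl) x∈ p with q , q∈ , refl ← columns-∈ Ds (B⊆xs β∈B) j =
      splits (∈-map⁺ (⁅_⁆ ∘_) q∈) x∈ p

    separate : ∀ {j j′ f} → Automorphism C f →
               (∀ {Q} → Q List.∈ Qs → ∀ x → (x ∈ Q j → f x ∈ Q j′) × (f x ∈ Q j′ → x ∈ Q j)) →
               (∀ x → f x ≡ x) × (∀ {D} → D List.∈ Ds → j ∈ D → j′ ∈ D)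
    separate {j} {j′} {f} automorphism moves = trivial ,
      columns-agree xs Ds unique (λ q∈ → trans (sym (trivial _)) (moved q∈))
      where
      moved : ∀ {q} → q List.∈ columns xs Ds → f (q j) ≡ q j′
      moved {q} q∈ = x∈⁅y⁆⇒x≡y (q j′) (proj₁ (moves (∈-map⁺ (⁅_⁆ ∘_) q∈) (q j)) (x∈⁅x⁆ (q j)))

      stable : ∀ {X} → singletons B X → ∀ {x} → x ∈ X → f x ∈ X
      stable (β , β∈B , refl) x∈ with refl ← x∈⁅y⁆⇒x≡y β x∈ =
        subst (_∈ ⁅ β ⁆) (sym (columns-fixed (antisymmetric-equivalence coherent antisymmetric) automorphism
          xs Ds unique moved (B⊆xs β∈B))) (x∈⁅x⁆ β)

      trivial : ∀ x → f x ≡ x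
      trivial = automorphism-trivial automorphism baseY (equivalence-refines coherent) stable

-- Cardinalities and the two bounds.

∣p∪q∣≤∣p∣+∣q∣ : ∀ (p q : Subset n) → ∣ p ∪ q ∣ ≤ ∣ p ∣ + ∣ q ∣
∣p∪q∣≤∣p∣+∣q∣ []            []            = z≤n
∣p∪q∣≤∣p∣+∣q∣ (outside ∷ p) (outside ∷ q) = ∣p∪q∣≤∣p∣+∣q∣ p q
∣p∪q∣≤∣p∣+∣q∣ (outside ∷ p) (inside  ∷ q) = ℕ.≤-trans (s≤s (∣p∪q∣≤∣p∣+∣q∣ p q)) (ℕ.≤-reflexive (sym (ℕ.+-suc ∣ p ∣ ∣ q ∣)))
∣p∪q∣≤∣p∣+∣q∣ (inside  ∷ p) (outside ∷ q) = s≤s (∣p∪q∣≤∣p∣+∣q∣ p q)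
∣p∪q∣≤∣p∣+∣q∣ (inside  ∷ p) (inside  ∷ q) =
  s≤s (ℕ.≤-trans (∣p∪q∣≤∣p∣+∣q∣ p q) (ℕ.+-monoʳ-≤ ∣ p ∣ (ℕ.n≤1+n ∣ q ∣)))

∣⋃⁅⁆∣≤length : ∀ (xs : List (Fin n)) → ∣ ⋃ (map ⁅_⁆ xs) ∣ ≤ length xs
∣⋃⁅⁆∣≤length {n} []       = ℕ.≤-reflexive (∣⊥∣≡0 n)
∣⋃⁅⁆∣≤length     (x ∷ xs) = begin
  ∣ ⁅ x ⁆ ∪ ⋃ (map ⁅_⁆ xs) ∣      ≤⟨ ∣p∪q∣≤∣p∣+∣q∣ ⁅ x ⁆ (⋃ (map ⁅_⁆ xs)) ⟩
  ∣ ⁅ x ⁆ ∣ + ∣ ⋃ (map ⁅_⁆ xs) ∣  ≤⟨ ℕ.+-mono-≤ (ℕ.≤-reflexive (∣⁅x⁆∣≡1 x)) (∣⋃⁅⁆∣≤length xs) ⟩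
  suc (length xs)                 ∎
  where open ℕ.≤-Reasoning

distinct-points : ∀ n → (∃₂ λ (x y : Fin n) → x ≢ y) ⊎ (∀ (x y : Fin n) → x ≡ y)
distinct-points zero          = inj₂ λ ()
distinct-points (suc zero)    = inj₂ λ { zero zero → refl }
distinct-points (suc (suc n)) = inj₁ (zero , suc zero , λ ())

module _ {Y : Configuration n} {L : PermutationGroup m} where
  open Tuples n m

  -- A power of a set with at most one point has at most one point, so every fission is discrete.
  trivial⇒generalizedBase : (∀ (x y : Fin n) → x ≡ y) → ∀ Π → IsGeneralizedBase (Y ↑ L) Π
  trivial⇒generalizedBase trivial Π = discrete⇒generalizedBase λ _ _ _ _ → !-ext λ k → trivial _ _

  gb-bound : IsCoherent Y → IsAntisymmetric Y → ∀ {gbY b gbY↑L} → Isgb Y gbY → Isgb (Inv L) b →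
             Isgb (Y ↑ L) gbY↑L → gbY↑L ≤ gbY ⊔ b
  gb-bound coherent antisymmetric ((Xs , _ , refl , baseY) , _) ((Ds , _ , refl , baseL) , _) (_ , minimal)
    with distinct-points n
  ... | inj₂ trivial = ℕ.≤-trans (minimal 0 ([] , [] , refl , trivial⇒generalizedBase trivial _)) z≤n
  ... | inj₁ (x₀ , y₀ , x₀≢y₀) = begin
    _                                 ≤⟨ minimal (length Π) (Π , DecUnique.deduplicate-! _≟ˢ_ Zs , refl , base) ⟩
    length Π                          ≤⟨ length-deduplicate _≟ˢ_ Zs ⟩
    length Zs                         ≡⟨ length-map product Qs ⟩
    length Qs                         ≡⟨ length-map (uncurry flipBy) (align Xs Ds) ⟩
    length (align Xs Ds)              ≡⟨ length-align Xs Ds ⟩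
    length Xs ⊔ length Ds             ∎
    where
    open ℕ.≤-Reasoning
    open SetEncoding x₀≢y₀

    _≟ˢ_ : DecidableEquality (Subset (n ^ m))
    _≟ˢ_ = ≡-dec Bool._≟_

    Qs : List (Fin m → Subset n)
    Qs = map (uncurry flipBy) (align Xs Ds)

    in-product? : ∀ (Q : Fin m → Subset n) α → Dec (∀ k → α ! k ∈ Q k)
    in-product? Q α = all? (λ k → α ! k ∈? Q k)

    product : (Fin m → Subset n) → Subset (n ^ m)
    product Q = ⟦ in-product? Q ⟧

    Zs Π : List (Subset (n ^ m))
    Zs = map product Qs
    -- Different pairs may yield the same product, and a generalized base is listed without
    -- repetition.
    Π = deduplicate _≟ˢ_ Zs

    base : IsGeneralizedBase (Y ↑ L) (List._∈ Π)
    base = encoding⇒generalizedBase coherent antisymmetric L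
      (setEncoding coherent antisymmetric L baseY baseL) x₀≢y₀
      λ {Q} Q∈ → product Q , ∈-deduplicate⁺ _≟ˢ_ (∈-map⁺ product Q∈) ,
        λ α → ∈⟦⟧⁻ (in-product? Q) , ∈⟦⟧⁺ (in-product? Q)

  b-bound : IsCoherent Y → IsAntisymmetric Y → ∀ {bY b bY↑L} → Isb Y bY → Isgb (Inv L) b →
            Isb (Y ↑ L) bY↑L → bY↑L ≤ bY + (b ∸ ⌈ bY ∸ 1 /2⌉)
  b-bound coherent antisymmetric ((B , refl , baseY) , _) ((Ds , _ , refl , baseL) , _) (_ , minimal)
    with distinct-points n
  ... | inj₂ trivial = ℕ.≤-trans (minimal 0 (⊥ , ∣⊥∣≡0 (n ^ m) , trivial⇒generalizedBase trivial _)) z≤n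
  ... | inj₁ (x₀ , y₀ , x₀≢y₀) = begin
    _                         ≤⟨ minimal ∣ B↑ ∣ (B↑ , refl , base) ⟩
    ∣ B↑ ∣                    ≤⟨ ∣⋃⁅⁆∣≤length (map tuple qs) ⟩
    length (map tuple qs)     ≡⟨ length-map tuple qs ⟩
    length qs                 ≡⟨ length-columns xs Ds ⟩
    length xs + (length Ds ∸ ⌈ length xs ∸ 1 /2⌉)
                              ≡⟨ cong (λ a → a + (length Ds ∸ ⌈ a ∸ 1 /2⌉)) (length-tabulate (nth B)) ⟩
    ∣ B ∣ + (length Ds ∸ ⌈ ∣ B ∣ ∸ 1 /2⌉) ∎
    where
    open ℕ.≤-Reasoning
    open PointEncoding x₀≢y₀

    xs : List (Fin n)
    xs = tabulate (nth B)

    B⊆xs : ∀ {x} → x ∈ B → x List.∈ xs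
    B⊆xs x∈B = subst (List._∈ xs) (nth-rank x∈B) (∈-tabulate⁺ (rank x∈B))

    qs : List (Fin m → Fin n)
    qs = columns xs Ds

    B↑ : Subset (n ^ m)
    B↑ = ⋃ (map ⁅_⁆ (map tuple qs))

    tuple-Product : ∀ q → IsProduct n m (⁅_⁆ ∘ q) ⁅ tuple q ⁆
    tuple-Product q α = to , from
      where
      to : α ∈ ⁅ tuple q ⁆ → ∀ k → α ! k ∈ ⁅ q k ⁆
      to α∈ k with refl ← x∈⁅y⁆⇒x≡y (tuple q) α∈ = subst (_∈ ⁅ q k ⁆) (sym (tuple-! q k)) (x∈⁅x⁆ (q k))

      from : (∀ k → α ! k ∈ ⁅ q k ⁆) → α ∈ ⁅ tuple q ⁆
      from h = subst (_∈ ⁅ tuple q ⁆) (!-ext λ k → trans (tuple-! q k) (sym (x∈⁅y⁆⇒x≡y (q k) (h k)))) (x∈⁅x⁆ (tuple q))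

    base : IsBase (Y ↑ L) B↑
    base = encoding⇒generalizedBase coherent antisymmetric L
      (pointEncoding coherent antisymmetric L B⊆xs (Unique.tabulate⁺ (nth-injective B)) baseY baseL) x₀≢y₀ products
      where
      products : ∀ {Q} → Q List.∈ map (⁅_⁆ ∘_) qs → ∃ λ Z → singletons B↑ Z × IsProduct n m Q Z
      products Q∈ with q , q∈ , refl ← ∈-map⁻ (⁅_⁆ ∘_) Q∈ = ⁅ tuple q ⁆ ,
        (tuple q , ∈-⋃⁺ (lose (∈-map⁺ ⁅_⁆ (∈-map⁺ tuple q∈)) (x∈⁅x⁆ (tuple q))) , refl) , tuple-Product q

theorem7p1 : ∀ {n m : ℕ} (Y : Configuration n) (L : PermutationGroup m) →
    IsCoherent Y → IsAntisymmetric Y → IsTransitive L → HasOddOrder L →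
    ∀ {b} → Isgb (Inv L) b →
    (∀ {gbY gbY↑L} → Isgb Y gbY → Isgb (Y ↑ L) gbY↑L → gbY↑L ≤ gbY ⊔ b)
    ×
    (¬ IsComplete Y → ∀ {bY bY↑L} → Isb Y bY → Isb (Y ↑ L) bY↑L →
    bY↑L ≤ bY + (0 ⊔ (b ∸ ⌈ bY ∸ 1 /2⌉)))
-- `0 ⊔ k` reduces to `k`, so the second bound has the required form.
theorem7p1 Y L coherent antisymmetric _ _ gbL =
  (λ gbY gbY↑L → gb-bound {Y = Y} {L} coherent antisymmetric gbY gbL gbY↑L) ,
  (λ _ bY bY↑L → b-bound {Y = Y} {L} coherent antisymmetric bY gbL bY↑L)
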